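{- Let $Y$ be a graph on $n\ge 4$ vertices. Then the friends-and-strangers graph $\mathsf{FS}(K_{2,n-2},Y)$ is connected if and only if $Y$ is a connected non-bipartite graph with no non-trivial cut edge and $Y$ is not (isomorphic to) the cycle $C_n$.
   Context: All graphs are finite and simple, without loops. $C_n$ is the cycle on $n$ vertices and $K_{2,n-2}$ is the complete bipartite graph with parts of sizes $2$ and $n-2$. Friends-and-strangers graph: for graphs $X,Y$ each with $n$ vertices, $\mathsf{FS}(X,Y)$ is the graph whose vertices are all bijections $\sigma:V(X)\to V(Y)$; two bijections $\sigma,\sigma'$ are adjacent if and only if there is an edge $ab\in E(X)$ such that $\sigma(a)\sigma(b)\in E(Y)$, $\sigma(a)=\sigma'(b)$, $\sigma(b)=\sigma'(a)$, and $\sigma(c)=\sigma'(c)$ for all $c\in V(X)\setminus\{a,b\}$. A cut edge of a connected graph is an edge whose removal results in a disconnected graph; a cut edge is non-trivial if neither of its ends has degree one. -}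

module Defs where

open import Data.Bool.Base using (Bool)
open import Data.Fin.Base using (Fin; toℕ)
open import Data.Fin.Permutation using (Permutation; _⟨$⟩ʳ_; _≈_)
open import Data.Fin.Properties using (any?; all?; _≟_)
open import Data.List.Base using (allFin; filter; length)
open import Data.Nat.Base using (ℕ; suc; _+_; _≤_; _<_; s≤s)
open import Data.Nat.Properties as ℕ using (_≤?_; _<?_; <⇒≱; 1+n≢n)
open import Data.Product.Base using (_×_; _,_; ∃; ∃-syntax; Σ-syntax; proj₁)
open import Data.Sum.Base as Sum using (_⊎_; inj₁; inj₂; swap)
open import Function.Base using (_∘_)
open import Function.Bundles using (_⇔_)
open import Level using (0ℓ)
open import Relation.Binary.Bundles using (Setoid)
open import Relation.Binary.Construct.Closure.ReflexiveTransitive using (Star)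
open import Relation.Binary.Core using (Rel)
open import Relation.Binary.Definitions
  using (Decidable; Symmetric; Irreflexive; _Respects₂_)
open import Relation.Binary.PropositionalEquality
  using (_≡_; _≢_; refl; sym; trans; cong; subst; subst₂; setoid; resp₂)
open import Relation.Nullary using (¬_)
open import Relation.Nullary.Decidable using (_×-dec_; _⊎-dec_; _→-dec_; ¬?)

-- The vertices form a setoid because bijections, the vertices of a
-- friends-and-strangers graph, are compared pointwise.

record Graph (V : Setoid 0ℓ 0ℓ) : Set₁ where
  private module V = Setoid V
  field
    Adj     : Rel V.Carrier 0ℓ
    adj?    : Decidable Adj
    symm    : Symmetric Adj
    irrefl  : Irreflexive V._≈_ Adj
    resp    : Adj Respects₂ V._≈_

open Graph public

FinGraph : ℕ → Set₁
FinGraph n = Graph (setoid (Fin n))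

-- The last vertex of a walk is only determined up to the vertex equality.

Connected : {V : Setoid 0ℓ 0ℓ} → Graph V → Set
Connected {V} G = ∀ u v → ∃[ w ] (Star (Adj G) u w × Setoid._≈_ V w v)

private
  variable
    m n : ℕ

_≅_ : FinGraph m → FinGraph n → Set
_≅_ {m} {n} G H = Σ[ π ∈ Permutation m n ]
  (∀ u v → Adj G u v ⇔ Adj H (π ⟨$⟩ʳ u) (π ⟨$⟩ʳ v))

Bipartite : FinGraph n → Set
Bipartite {n} G =
  Σ[ part ∈ (Fin n → Bool) ] (∀ u v → Adj G u v → part u ≢ part v)

degree : FinGraph n → Fin n → ℕ
degree {n} G v = length (filter (adj? G v) (allFin n))

SamePair : Fin n → Fin n → Fin n → Fin n → Set
SamePair a b u v = (u ≡ a × v ≡ b) ⊎ (u ≡ b × v ≡ a)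

deleteEdge : FinGraph n → Fin n → Fin n → FinGraph n
deleteEdge G a b = record
  { Adj    = Adj′
  ; adj?   = λ u v → adj? G u v ×-dec
               ¬? (((u ≟ a) ×-dec (v ≟ b)) ⊎-dec ((u ≟ b) ×-dec (v ≟ a)))
  ; symm   = λ (uv , ≢e) → symm G uv , ≢e ∘ flipPair
  ; irrefl = λ u≡v → irrefl G u≡v ∘ proj₁
  ; resp   = resp₂ Adj′
  }
  where
  Adj′ : Rel _ 0ℓ
  Adj′ u v = Adj G u v × ¬ SamePair a b u v

  flipPair : ∀ {u v} → SamePair a b v u → SamePair a b u v
  flipPair (inj₁ (p , q)) = inj₂ (q , p)
  flipPair (inj₂ (p , q)) = inj₁ (q , p)

-- Meant for connected G.

CutEdge : FinGraph n → Fin n → Fin n → Set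
CutEdge G a b = Adj G a b × ¬ Connected (deleteEdge G a b)

NonTrivialCutEdge : FinGraph n → Fin n → Fin n → Set
NonTrivialCutEdge G a b = CutEdge G a b × degree G a ≢ 1 × degree G b ≢ 1

-- Fewer than three vertices would give a loop or a doubled edge.

cycle : (n : ℕ) → 3 ≤ n → FinGraph n
cycle n 3≤n = record
  { Adj    = λ i j → Next i j ⊎ Next j i
  ; adj?   = λ i j → next? i j ⊎-dec next? j i
  ; symm   = swap
  ; irrefl = λ { refl → Sum.[ noLoop , noLoop ] }
  ; resp   = resp₂ (λ i j → Next i j ⊎ Next j i)
  }
  where
  Next : Rel (Fin n) 0ℓ
  Next i j = suc (toℕ i) ≡ toℕ j ⊎ (suc (toℕ i) ≡ n × toℕ j ≡ 0)

  next? : Decidable Next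
  next? i j = (suc (toℕ i) ℕ.≟ toℕ j)
    ⊎-dec ((suc (toℕ i) ℕ.≟ n) ×-dec (toℕ j ℕ.≟ 0))

  noLoop : ∀ {i} → ¬ Next i i
  noLoop (inj₁ 1+i≡i) = 1+n≢n 1+i≡i
  noLoop (inj₂ (1+i≡n , i≡0))
    with subst (3 ≤_) (trans (sym 1+i≡n) (cong suc i≡0)) 3≤n
  ... | s≤s ()

-- The part of size p consists of the vertices 0, …, p - 1.

completeBipartite : (p q : ℕ) → FinGraph (p + q)
completeBipartite p q = record
  { Adj    = λ i j → Across i j ⊎ Across j i
  ; adj?   = λ i j → across? i j ⊎-dec across? j i
  ; symm   = swap
  ; irrefl = λ { refl → Sum.[ noLoop , noLoop ] }
  ; resp   = resp₂ (λ i j → Across i j ⊎ Across j i)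
  }
  where
  Across : Rel (Fin (p + q)) 0ℓ
  Across i j = toℕ i < p × p ≤ toℕ j

  across? : Decidable Across
  across? i j = (toℕ i <? p) ×-dec (p ≤? toℕ j)

  noLoop : ∀ {i} → ¬ Across i i
  noLoop (i<p , p≤i) = <⇒≱ i<p p≤i

bijections : ℕ → ℕ → Setoid 0ℓ 0ℓ
bijections m n = record
  { Carrier       = Permutation m n
  ; _≈_           = _≈_
  ; isEquivalence = record
    { refl  = λ _ → refl
    ; sym   = λ p i → sym (p i)
    ; trans = λ p q i → trans (p i) (q i)
    }
  }

-- The numbers of vertices m and n may differ syntactically, as
-- 2 + (n ∸ 2) and n do; bijections exist only when m ≡ n.

FS : FinGraph m → FinGraph n → Graph (bijections m n)
FS {m} {n} X Y = record
  { Adj    = Swap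
  ; adj?   = λ σ τ → any? λ a → any? λ b →
               adj? X a b
               ×-dec adj? Y (σ ⟨$⟩ʳ a) (σ ⟨$⟩ʳ b)
               ×-dec (σ ⟨$⟩ʳ a ≟ τ ⟨$⟩ʳ b)
               ×-dec (σ ⟨$⟩ʳ b ≟ τ ⟨$⟩ʳ a)
               ×-dec all? λ c → ¬? (c ≟ a) →-dec (¬? (c ≟ b) →-dec
                                 (σ ⟨$⟩ʳ c ≟ τ ⟨$⟩ʳ c))
  ; symm   = λ (a , b , ab , σaσb , p , q , r) →
               a , b , ab , symm Y (subst₂ (Adj Y) p q σaσb)
               , sym q , sym p , λ c c≢a c≢b → sym (r c c≢a c≢b)
  ; irrefl = λ { σ≈τ (a , b , ab , σaσb , p , q , r) →
               irrefl Y (trans p (sym (σ≈τ b))) σaσb }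
  ; resp   = (λ { τ≈τ′ (a , b , ab , σaσb , p , q , r) →
                 a , b , ab , σaσb , trans p (τ≈τ′ b) , trans q (τ≈τ′ a)
                 , λ c c≢a c≢b → trans (r c c≢a c≢b) (τ≈τ′ c) })
           , (λ { σ≈σ′ (a , b , ab , σaσb , p , q , r) →
                 a , b , ab , subst₂ (Adj Y) (σ≈σ′ a) (σ≈σ′ b) σaσb
                 , trans (sym (σ≈σ′ a)) p , trans (sym (σ≈σ′ b)) q
                 , λ c c≢a c≢b → trans (sym (σ≈σ′ c)) (r c c≢a c≢b) })
  }
  where
  Swap : Rel (Permutation m n) 0ℓ
  Swap σ τ = ∃ λ (a : Fin m) → ∃ λ (b : Fin m) →
    Adj X a b
    × Adj Y (σ ⟨$⟩ʳ a) (σ ⟨$⟩ʳ b)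
    × σ ⟨$⟩ʳ a ≡ τ ⟨$⟩ʳ b
    × σ ⟨$⟩ʳ b ≡ τ ⟨$⟩ʳ a
    × (∀ c → c ≢ a → c ≢ b → σ ⟨$⟩ʳ c ≡ τ ⟨$⟩ʳ c)

-- Call the labels 0 and 1, which form the part of size 2, blanks, and the other
-- labels tokens: a step of FS(K_{2,n-2}, Y) moves a blank along an edge of Y by
-- exchanging it with a token.
--
-- Necessity.  A label walks along Y, so Y is connected.  If Y is bipartite, the
-- sign of the bijection combined with the colours of the two blanks is
-- invariant.  Across a non-trivial cut edge, every token belongs to one side
-- for good.  On a cycle, the cyclic order of three tokens is invariant (for
-- n = 4 the cycle is bipartite).
--
-- Sufficiency.  Let σ ≈ τ mean that τ is reachable from σ up to an exchange of
-- the blanks, and call a set S of vertices exchangeable if σ ≈ τ whenever both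
-- have their blanks in S and agree outside S.  A path with three vertices is
-- exchangeable, and an exchangeable set can be enlarged one vertex w at a time,
-- by bringing an arbitrary token of S to w.  If w is adjacent to a vertex of S
-- with two neighbours in S, this is done inside S ∪ {w}; otherwise w lies on a
-- walk through the complement of S that leaves and enters S at distinct
-- vertices, because Y has no non-trivial cut edge, and a blank runs along this
-- walk and back.  The first enlargement is made at a vertex r of degree at
-- least 3, which exists as Y is not a cycle.  Hence all bijections are
-- ≈-related.  An explicit manoeuvre at r exchanges the blanks together with two
-- tokens.  So a blank that moves around an odd closed walk, and thus permutes
-- the tokens oddly, lets the two blanks be exchanged.  In the proof, this is a
-- colouring of Y that would be proper if the blanks could not be exchanged.

module Submission where

open import Defs
open import Algebra.Bundles using (CommutativeRing)
import Algebra.Properties.CommutativeMonoid.Sum as CommutativeMonoidSum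
open import Data.Bool.Base using (Bool; true; false; not; _xor_; _∨_; _∧_)
import Data.Bool.Properties as Bool
open import Data.Fin.Base using (Fin; zero; suc; toℕ; fromℕ<)
open import Data.Fin.Permutation as Permutation
  using (Permutation; Permutation′; _⟨$⟩ʳ_; _⟨$⟩ˡ_; inverseˡ; inverseʳ; _∘ₚ_; transpose
        ; permutation)
import Data.Fin.Permutation.Components as PC
open import Data.Fin.Properties as Fin
  using (_≟_; any?; injective⇒≤; toℕ-fromℕ<; toℕ-injective; toℕ<n)
open import Data.List.Base using (List; []; _∷_; length; lookup; filter; allFin)
import Data.List.Membership.DecPropositional as DecMembership
open import Data.List.Membership.Propositional using (_∈_; _∉_)
open import Data.List.Membership.Propositional.Properties
  using (∈-lookup; ∈-filter⁺; ∈-filter⁻; ∈-allFin)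
open import Data.List.Properties using (length-tabulate)
open import Data.List.Relation.Unary.All as All using ([]; _∷_)
open import Data.List.Relation.Unary.All.Properties using (¬Any⇒All¬)
open import Data.List.Relation.Unary.AllPairs using ([]; _∷_)
open import Data.List.Relation.Unary.Any using (here; there; index)
open import Data.List.Relation.Unary.Any.Properties using (lookup-index)
open import Data.List.Relation.Unary.Unique.Propositional using (Unique)
open import Data.List.Relation.Unary.Unique.Propositional.Properties using (filter⁺; allFin⁺)
open import Data.Nat.Base using (ℕ; zero; suc; _+_; _∸_; _≤_; _<_; z≤n; s≤s)
open import Data.Nat.Properties as ℕ
  using (_<?_; <-cmp; ≤-trans; ≤-reflexive; ≤-antisym; <⇒≤; <⇒≱; n<1+n; <-≤-trans; ≤∧≢⇒<
        ; +-suc; m≤n⇒m<n∨m≡n; anyUpTo?)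
open import Data.Product.Base using (_×_; _,_; ∃; ∃-syntax; proj₁; proj₂)
open import Data.Sum.Base using (_⊎_; inj₁; inj₂)
open import Function.Base using (_∘_)
open import Function.Bundles using (_⇔_; mk⇔; Equivalence)
open import Relation.Binary.Construct.Closure.ReflexiveTransitive as Star using (Star; ε; _◅_; _◅◅_)
open import Relation.Binary.Definitions using (tri<; tri≈; tri>)
open import Relation.Binary.PropositionalEquality
  using (_≡_; _≢_; _≗_; refl; sym; trans; cong; cong₂; subst; subst₂; ≢-sym; module ≡-Reasoning)
open import Relation.Nullary using (¬_; Dec; does; yes; no; contradiction)
open import Relation.Nullary.Decidable
  using (_×-dec_; _⊎-dec_; ¬?; decidable-stable; dec-true; dec-false)
open import Relation.Unary using (Decidable)

private
  variable
    k m n : ℕ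

-- Transpositions and bijections

transpose-first : (i j : Fin n) → PC.transpose i j i ≡ j
transpose-first i j rewrite dec-true (i ≟ i) refl = refl

transpose-second : (i j : Fin n) → PC.transpose i j j ≡ i
transpose-second i j with j ≟ i
... | yes refl = refl
... | no _ rewrite dec-true (j ≟ j) refl = refl

transpose-other : {i j l : Fin n} → l ≢ i → l ≢ j → PC.transpose i j l ≡ l
transpose-other {i = i} {j} {l} l≢i l≢j
  rewrite dec-false (l ≟ i) l≢i | dec-false (l ≟ j) l≢j = refl

transpose-involutive : (i j l : Fin n) →
  PC.transpose i j (PC.transpose i j l) ≡ l
transpose-involutive i j l with l ≟ i
... | yes refl = transpose-second l j
... | no l≢i with l ≟ j
...   | yes refl = transpose-first i l
...   | no l≢j = transpose-other l≢i l≢j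

infixl 20 _[_⇄_]

opaque

  -- Precomposition exchanges the places of two labels. It is opaque so that goals keep this form
  -- instead of unfolding to `transpose`.
  _[_⇄_] : Permutation m n → Fin m → Fin m → Permutation m n
  σ [ x ⇄ y ] = transpose x y ∘ₚ σ

  ⇄-transpose : (σ : Permutation m n) (x y z : Fin m) →
    σ [ x ⇄ y ] ⟨$⟩ʳ z ≡ σ ⟨$⟩ʳ PC.transpose x y z
  ⇄-transpose σ x y z = refl

module _ (σ : Permutation m n) where

  injective : ∀ {x y} → σ ⟨$⟩ʳ x ≡ σ ⟨$⟩ʳ y → x ≡ y
  injective σx≡σy = trans (sym (inverseˡ σ)) (trans (cong (σ ⟨$⟩ˡ_) σx≡σy) (inverseˡ σ))

  distinct : ∀ {x y} → x ≢ y → σ ⟨$⟩ʳ x ≢ σ ⟨$⟩ʳ y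
  distinct x≢y = x≢y ∘ injective

  distinct⁻ : ∀ {x y p q} → σ ⟨$⟩ʳ x ≡ p → σ ⟨$⟩ʳ y ≡ q → p ≢ q → x ≢ y
  distinct⁻ refl refl p≢q refl = p≢q refl

  ⇄-first : ∀ x y → σ [ x ⇄ y ] ⟨$⟩ʳ x ≡ σ ⟨$⟩ʳ y
  ⇄-first x y = trans (⇄-transpose σ x y x) (cong (σ ⟨$⟩ʳ_) (transpose-first x y))

  ⇄-second : ∀ x y → σ [ x ⇄ y ] ⟨$⟩ʳ y ≡ σ ⟨$⟩ʳ x
  ⇄-second x y = trans (⇄-transpose σ x y y) (cong (σ ⟨$⟩ʳ_) (transpose-second x y))

  ⇄-other : ∀ {x y z} → z ≢ x → z ≢ y → σ [ x ⇄ y ] ⟨$⟩ʳ z ≡ σ ⟨$⟩ʳ z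
  ⇄-other z≢x z≢y = trans (⇄-transpose σ _ _ _) (cong (σ ⟨$⟩ʳ_) (transpose-other z≢x z≢y))

-- The two sides of the complete bipartite graph

pattern A = zero
pattern B = suc zero

-- The side of a label in K_{2,k}; the labels on the side of size 2 play the
-- role of blanks, the others that of tokens.

blank : Fin (2 + k) → Bool
blank A = true
blank B = true
blank (suc (suc _)) = false

token≢blank : {x y : Fin (2 + k)} → blank x ≡ true → blank y ≡ false → y ≢ x
token≢blank bx by refl with trans (sym bx) by
... | ()

blank-adj : {x y : Fin (2 + k)} → blank x ≡ true → blank y ≡ false →
  Adj (completeBipartite 2 k) x y
blank-adj {x = A} {suc (suc _)} _ _ = inj₁ (s≤s z≤n , s≤s (s≤s z≤n))
blank-adj {x = B} {suc (suc _)} _ _ = inj₁ (s≤s (s≤s z≤n) , s≤s (s≤s z≤n))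

adj-blank : {x y : Fin (2 + k)} → Adj (completeBipartite 2 k) x y →
  (blank x ≡ true × blank y ≡ false) ⊎ (blank y ≡ true × blank x ≡ false)
adj-blank {x = A} {suc (suc _)} _ = inj₁ (refl , refl)
adj-blank {x = B} {suc (suc _)} _ = inj₁ (refl , refl)
adj-blank {x = suc (suc _)} {A} _ = inj₂ (refl , refl)
adj-blank {x = suc (suc _)} {B} _ = inj₂ (refl , refl)
adj-blank {x = A} {A} (inj₁ (_ , ()))
adj-blank {x = A} {A} (inj₂ (_ , ()))
adj-blank {x = A} {B} (inj₁ (_ , s≤s ()))
adj-blank {x = A} {B} (inj₂ (_ , ()))
adj-blank {x = B} {A} (inj₁ (_ , ()))
adj-blank {x = B} {A} (inj₂ (_ , s≤s ()))
adj-blank {x = B} {B} (inj₁ (_ , s≤s ()))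
adj-blank {x = B} {B} (inj₂ (_ , s≤s ()))
adj-blank {x = suc (suc _)} {suc (suc _)} (inj₁ (s≤s (s≤s ()) , _))
adj-blank {x = suc (suc _)} {suc (suc _)} (inj₂ (s≤s (s≤s ()) , _))

adj-resp-blank : {x y x′ y′ : Fin (2 + k)} → blank x′ ≡ blank x → blank y′ ≡ blank y →
  Adj (completeBipartite 2 k) x y → Adj (completeBipartite 2 k) x′ y′
adj-resp-blank p q xy with adj-blank xy
... | inj₁ (bx , by) = blank-adj (trans p bx) (trans q by)
... | inj₂ (by , bx) = symm (completeBipartite 2 _) (blank-adj (trans q by) (trans p bx))

transpose-blank : {x y : Fin (2 + k)} → blank x ≡ blank y → ∀ z →
  blank (PC.transpose x y z) ≡ blank z
transpose-blank {x = x} {y} x∼y z with z ≟ x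
... | yes refl = sym x∼y
... | no z≢x with z ≟ y
...   | yes refl = x∼y
...   | no z≢y = refl

-- Reachability and the exchange of the blanks

module Reach {k : ℕ} (Y : FinGraph (2 + k)) where

  Label : Set
  Label = Fin (2 + k)

  Vertex : Set
  Vertex = Fin (2 + k)

  State : Set
  State = Permutation′ (2 + k)

  G : Graph (bijections (2 + k) (2 + k))
  G = FS (completeBipartite 2 k) Y

  infix 4 _≐_ _~_ _~[_]_ _≈_

  -- A record, because `σ` and `τ` cannot be inferred from a bare pointwise equation.
  record _≐_ (σ τ : State) : Set where
    constructor pointwise
    field at : ∀ x → σ ⟨$⟩ʳ x ≡ τ ⟨$⟩ʳ x

  open _≐_ public

  ≐-sym : ∀ {σ τ} → σ ≐ τ → τ ≐ σ
  ≐-sym (pointwise p) = pointwise λ x → sym (p x)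

  ≐-trans : ∀ {σ τ υ} → σ ≐ τ → τ ≐ υ → σ ≐ υ
  ≐-trans (pointwise p) (pointwise q) = pointwise λ x → trans (p x) (q x)

  record _~_ (σ τ : State) : Set where
    constructor reach
    field
      {end} : State
      path  : Star (Adj G) σ end
      end≐  : end ≐ τ

  ≐⇒~ : ∀ {σ τ} → σ ≐ τ → σ ~ τ
  ≐⇒~ = reach ε

  ~-refl : ∀ {σ} → σ ~ σ
  ~-refl = ≐⇒~ (pointwise λ _ → refl)

  ~-respˡ : ∀ {σ σ′ τ} → σ ≐ σ′ → σ′ ~ τ → σ ~ τ
  ~-respˡ σ≐σ′ (reach ε σ′≐τ) = ≐⇒~ (≐-trans σ≐σ′ σ′≐τ)
  ~-respˡ {σ} {σ′} σ≐σ′ (reach (_◅_ {j = ρ} e es) υ≐τ) =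
    reach (proj₂ (resp G) {ρ} {σ′} {σ} (at (≐-sym σ≐σ′)) e ◅ es) υ≐τ

  ~-trans : ∀ {σ τ υ} → σ ~ τ → τ ~ υ → σ ~ υ
  ~-trans (reach es ρ≐τ) τ~υ with ~-respˡ ρ≐τ τ~υ
  ... | reach es′ ρ′≐υ = reach (es ◅◅ es′) ρ′≐υ

  ~-sym : ∀ {σ τ} → σ ~ τ → τ ~ σ
  ~-sym (reach es υ≐τ) =
    ~-respˡ (≐-sym υ≐τ)
      (reach (Star.reverse (λ {σ} {τ} → symm G {σ} {τ}) es) (pointwise λ _ → refl))

  move : ∀ σ {x y} → blank x ≡ true → blank y ≡ false →
    Adj Y (σ ⟨$⟩ʳ x) (σ ⟨$⟩ʳ y) → σ ~ σ [ x ⇄ y ]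
  move σ {x} {y} bx by xy = reach
    (_◅_ {j = σ [ x ⇄ y ]}
      (x , y , blank-adj bx by , xy , sym (⇄-second σ x y) , sym (⇄-first σ x y)
        , λ _ z≢x z≢y → sym (⇄-other σ z≢x z≢y)) ε)
    (pointwise λ _ → refl)

  module _ {x y : Label} (x∼y : blank x ≡ blank y) where

    private
      t : Label → Label
      t = PC.transpose x y

      t-swap : ∀ {z a} → z ≢ t a → t z ≢ a
      t-swap z≢ta refl = z≢ta (sym (transpose-involutive x y _))

      opaque
        unfolding _[_⇄_]

        undo : ∀ (σ : State) a → σ [ x ⇄ y ] ⟨$⟩ʳ t a ≡ σ ⟨$⟩ʳ a
        undo σ a = cong (σ ⟨$⟩ʳ_) (transpose-involutive x y a)

    -- A transposition within one side is an automorphism of `completeBipartite 2 k`, so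
    -- precomposition with it is an automorphism of `G`.
    step-relabel : ∀ {σ τ} → Adj G σ τ → Adj G (σ [ x ⇄ y ]) (τ [ x ⇄ y ])
    step-relabel {σ} {τ} (a , b , ab , σaσb , p , q , r) =
      t a , t b
      , adj-resp-blank (transpose-blank x∼y a) (transpose-blank x∼y b) ab
      , subst₂ (Adj Y) (sym (undo σ a)) (sym (undo σ b)) σaσb
      , trans (undo σ a) (trans p (sym (undo τ b)))
      , trans (undo σ b) (trans q (sym (undo τ a)))
      , λ z z≢ta z≢tb → trans (⇄-transpose σ x y z)
          (trans (r (t z) (t-swap z≢ta) (t-swap z≢tb)) (sym (⇄-transpose τ x y z)))

    ~-relabel : ∀ {σ τ} → σ ~ τ → σ [ x ⇄ y ] ~ τ [ x ⇄ y ]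
    ~-relabel {τ = τ} (reach {end = υ} es υ≐τ) = reach
      (Star.gmap (_[ x ⇄ y ]) (λ {σ} {τ} → step-relabel {σ} {τ}) es)
      (pointwise λ z → trans (⇄-transpose υ x y z)
        (trans (at υ≐τ (t z)) (sym (⇄-transpose τ x y z))))

  ⇄-involutive : ∀ σ x y → σ [ x ⇄ y ] [ x ⇄ y ] ≐ σ
  ⇄-involutive σ x y = pointwise λ z → trans (⇄-transpose (σ [ x ⇄ y ]) x y z)
    (trans (⇄-transpose σ x y _) (cong (σ ⟨$⟩ʳ_) (transpose-involutive x y z)))

  twist : Bool → State → State
  twist false σ = σ
  twist true  σ = σ [ A ⇄ B ]

  ~-twist : ∀ b {σ τ} → σ ~ τ → twist b σ ~ twist b τ
  ~-twist false p = p
  ~-twist true  p = ~-relabel refl p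

  twist-twist : ∀ b c σ → twist b (twist c σ) ≐ twist (b xor c) σ
  twist-twist false c     σ = pointwise λ _ → refl
  twist-twist true  false σ = pointwise λ _ → refl
  twist-twist true  true  σ = ⇄-involutive σ A B

  -- The transposition of the blanks and that of two tokens are disjoint, hence commute.
  twist-relabel : ∀ b σ {x y} → blank x ≡ false → blank y ≡ false →
    twist b (σ [ x ⇄ y ]) ≐ twist b σ [ x ⇄ y ]
  twist-relabel false σ _ _ = pointwise λ _ → refl
  twist-relabel true σ {x} {y} tx ty = pointwise λ z →
    trans (⇄-transpose (σ [ x ⇄ y ]) A B z) (trans (⇄-transpose σ x y _)
      (trans (cong (σ ⟨$⟩ʳ_) (commute z))
        (sym (trans (⇄-transpose (σ [ A ⇄ B ]) x y z) (⇄-transpose σ A B _)))))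
    where
    fixes : ∀ w → blank w ≡ true → PC.transpose x y w ≡ w
    fixes w bw = transpose-other (≢-sym (token≢blank bw tx)) (≢-sym (token≢blank bw ty))

    fixes-token : ∀ w → blank w ≡ false → PC.transpose A B w ≡ w
    fixes-token w tw = transpose-other (token≢blank refl tw) (token≢blank refl tw)

    commute : ∀ z → PC.transpose x y (PC.transpose A B z)
                    ≡ PC.transpose A B (PC.transpose x y z)
    commute A = trans (fixes B refl) (cong (PC.transpose A B) (sym (fixes A refl)))
    commute B = trans (fixes A refl) (cong (PC.transpose A B) (sym (fixes B refl)))
    commute z@(suc (suc _)) =
      sym (fixes-token _ (transpose-blank (trans tx (sym ty)) z))

  -- The index counts exchanges of the blanks modulo 2 and is added along compositions. A loop with
  -- index `true` shows that the blanks of a state can be exchanged.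
  record _~[_]_ (σ : State) (b : Bool) (τ : State) : Set where
    constructor twisted
    field untwist : σ ~ twist b τ

  ~[]-trans : ∀ {b c σ τ υ} → σ ~[ b ] τ → τ ~[ c ] υ → σ ~[ b xor c ] υ
  ~[]-trans {b} {c} {υ = υ} (twisted p) (twisted q) =
    twisted (~-trans p (~-trans (~-twist b q) (≐⇒~ (twist-twist b c υ))))

  ~[]-sym : ∀ {b σ τ} → σ ~[ b ] τ → τ ~[ b ] σ
  ~[]-sym {false} (twisted p) = twisted (~-sym p)
  ~[]-sym {true} {τ = τ} (twisted p) =
    twisted (~-respˡ (≐-sym (⇄-involutive τ A B)) (~-twist true (~-sym p)))

  ~[]-relabel : ∀ {b σ τ x y} → blank x ≡ false → blank y ≡ false →
    σ ~[ b ] τ → σ [ x ⇄ y ] ~[ b ] τ [ x ⇄ y ]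
  ~[]-relabel {b} {τ = τ} tx ty (twisted p) = twisted
    (~-trans (~-relabel (trans tx (sym ty)) p) (≐⇒~ (≐-sym (twist-relabel b τ tx ty))))

  _≈_ : State → State → Set
  σ ≈ τ = ∃[ b ] σ ~[ b ] τ

  ~⇒≈ : ∀ {σ τ} → σ ~ τ → σ ≈ τ
  ~⇒≈ p = false , twisted p

  ≈-trans : ∀ {σ τ υ} → σ ≈ τ → τ ≈ υ → σ ≈ υ
  ≈-trans (b , p) (c , q) = b xor c , ~[]-trans p q

  ≈-sym : ∀ {σ τ} → σ ≈ τ → τ ≈ σ
  ≈-sym (b , p) = b , ~[]-sym p

  ≈-relabel : ∀ {σ τ x y} → blank x ≡ false → blank y ≡ false →
    σ ≈ τ → σ [ x ⇄ y ] ≈ τ [ x ⇄ y ]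
  ≈-relabel tx ty (b , p) = b , ~[]-relabel tx ty p

  ≈-twist : ∀ σ → σ ≈ σ [ A ⇄ B ]
  ≈-twist σ = true , twisted (≐⇒~ (≐-sym (⇄-involutive σ A B)))

-- Finite graphs

infix 4 _∈?_

_∈?_ : (x : Fin n) (xs : List (Fin n)) → Dec (x ∈ xs)
_∈?_ = DecMembership._∈?_ _≟_

lookup-injective : {xs : List (Fin n)} → Unique xs → ∀ {i j} →
  lookup xs i ≡ lookup xs j → i ≡ j
lookup-injective (_ ∷ _)  {zero}  {zero}  _  = refl
lookup-injective (x∉ ∷ _) {zero}  {suc j} eq = contradiction eq (All.lookup x∉ (∈-lookup j))
lookup-injective (x∉ ∷ _) {suc i} {zero}  eq = contradiction (sym eq) (All.lookup x∉ (∈-lookup i))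
lookup-injective (_ ∷ u)  {suc i} {suc j} eq = cong suc (lookup-injective u eq)

unique⇒length≤ : {xs : List (Fin n)} → Unique xs → length xs ≤ n
unique⇒length≤ u = injective⇒≤ (lookup-injective u)

-- Pigeonhole: otherwise, sending each position in `xs` to the position of its entry in `ys` would
-- be injective.
escape : {xs ys : List (Fin n)} → Unique xs → length ys < length xs →
  ∃ λ x → x ∈ xs × x ∉ ys
escape {xs = xs} {ys} unique short with any? (λ x → x ∈? xs ×-dec ¬? (x ∈? ys))
... | yes found = found
... | no none = contradiction (injective⇒≤ {f = slot} slot-injective) (<⇒≱ short)
  where
  covered : ∀ i → lookup xs i ∈ ys
  covered i = decidable-stable (_ ∈? ys) λ x∉ → none (lookup xs i , ∈-lookup i , x∉)

  slot : Fin (length xs) → Fin (length ys)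
  slot i = index (covered i)

  slot-injective : ∀ {i j} → slot i ≡ slot j → i ≡ j
  slot-injective {i} {j} eq = lookup-injective unique (trans (lookup-index (covered i))
    (trans (cong (lookup ys) eq) (sym (lookup-index (covered j)))))

fresh : (ys : List (Fin n)) → length ys < n → ∃[ w ] w ∉ ys
fresh {n} ys short
  with w , _ , w∉ ← escape (allFin⁺ n) (subst (length ys <_) (sym (length-tabulate _)) short) =
  w , w∉

-- Each new element keeps the list free of repetitions, so its length never exceeds `n`; `fuel`
-- bounds the number of elements that can still be added.
grow : {P Q : List (Fin n) → Set} →
  (∀ xs → P xs → Q xs ⊎ ∃ λ x → x ∉ xs × P (x ∷ xs)) →
  ∀ xs → Unique xs → P xs → ∃ λ ys → P ys × Q ys
grow {n} {P} {Q} step xs = go n xs (ℕ.m≤m+n n (length xs))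
  where
  go : ∀ fuel xs → n ≤ fuel + length xs → Unique xs → P xs → ∃ λ ys → P ys × Q ys
  go fuel xs enough u p with step xs p
  ... | inj₁ q = xs , p , q
  go zero xs enough u p | inj₂ (x , x∉ , _) =
    contradiction (≤-trans (unique⇒length≤ (¬Any⇒All¬ xs x∉ ∷ u)) enough) ℕ.1+n≰n
  go (suc fuel) xs enough u p | inj₂ (x , x∉ , p′) =
    go fuel (x ∷ xs) (subst (n ≤_) (sym (+-suc fuel (length xs))) enough)
      (¬Any⇒All¬ xs x∉ ∷ u) p′

module _ (G : FinGraph n) where

  walk : Connected G → ∀ u v → Star (Adj G) u v
  walk conn u v with conn u v
  ... | _ , es , refl = es

  walks⇒connected : (∀ u v → Star (Adj G) u v) → Connected G
  walks⇒connected walks u v = v , walks u v , refl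

  -- A set of reached vertices grows until it is closed under adjacency; a walk that starts in a
  -- closed set stays there.
  reachable? : ∀ u v → Dec (Star (Adj G) u v)
  reachable? u v = decide (grow step (u ∷ []) ([] ∷ []) (here refl , λ { (here refl) → ε }))
    where
    Reached Closed : List (Fin n) → Set
    Reached xs = u ∈ xs × (∀ {x} → x ∈ xs → Star (Adj G) u x)
    Closed xs = ∀ {x y} → x ∈ xs → Adj G x y → y ∈ xs

    step : ∀ xs → Reached xs → Closed xs ⊎ ∃ λ x → x ∉ xs × Reached (x ∷ xs)
    step xs (u∈ , reached) with any? (λ x → any? λ y → x ∈? xs ×-dec adj? G x y ×-dec ¬? (y ∈? xs))
    ... | yes (x , y , x∈ , xy , y∉) =
      inj₂ (y , y∉ , there u∈ , λ { (here refl) → reached x∈ ◅◅ xy ◅ ε ; (there z∈) → reached z∈ })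
    ... | no none =
      inj₁ λ x∈ xy → decidable-stable (_ ∈? xs) λ y∉ → none (_ , _ , x∈ , xy , y∉)

    decide : (∃ λ xs → Reached xs × Closed xs) → Dec (Star (Adj G) u v)
    decide (xs , (u∈ , reached) , closed) with v ∈? xs
    ... | yes v∈ = yes (reached v∈)
    ... | no v∉ = no λ es → v∉ (follow u∈ es)
      where
      follow : ∀ {x} → x ∈ xs → Star (Adj G) x v → v ∈ xs
      follow x∈ ε = x∈
      follow x∈ (e ◅ es) = follow (closed x∈ e) es

  crossing-edge : {P : Fin n → Set} → Decidable P → ∀ {u v} → P u → ¬ P v →
    Star (Adj G) u v → ∃ λ x → ∃ λ y → P x × Adj G x y × ¬ P y
  crossing-edge P? Pu ¬Pv ε = contradiction Pu ¬Pv
  crossing-edge P? Pu ¬Pv (_◅_ {j = w} e es) with P? w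
  ... | yes Pw = crossing-edge P? Pw ¬Pv es
  ... | no ¬Pw = _ , w , Pu , e , ¬Pw

  degree≢1 : ∀ {v x y} → Adj G v x → Adj G v y → x ≢ y → degree G v ≢ 1
  degree≢1 {v} {x} {y} vx vy x≢y =
    two (filter (adj? G v) (allFin n)) (mem vx) (mem vy)
    where
    mem : ∀ {z} → Adj G v z → z ∈ filter (adj? G v) (allFin n)
    mem vz = ∈-filter⁺ (adj? G v) (∈-allFin _) vz

    two : ∀ zs → x ∈ zs → y ∈ zs → length zs ≢ 1
    two (_ ∷ []) (here refl) (here refl) _ = x≢y refl

  second-neighbour : ∀ {v x} → degree G v ≢ 1 → Adj G v x → ∃ λ y → y ≢ x × Adj G v y
  second-neighbour {v} {x} deg vx =
    find (filter (adj? G v) (allFin n)) refl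
      (∈-filter⁺ (adj? G v) (∈-allFin x) vx) (filter⁺ (adj? G v) (allFin⁺ n))
    where
    find : ∀ zs → filter (adj? G v) (allFin n) ≡ zs → x ∈ zs → Unique zs →
      ∃ λ y → y ≢ x × Adj G v y
    find (_ ∷ []) eq _ _ = contradiction (cong length eq) deg
    find (y ∷ z ∷ _) eq x∈ ((y≢z ∷ _) ∷ _) with y ≟ x
    ... | no y≢x = y , y≢x
      , proj₂ (∈-filter⁻ (adj? G v) {xs = allFin n} (subst (y ∈_) (sym eq) (here refl)))
    ... | yes refl = z , ≢-sym y≢z
      , proj₂ (∈-filter⁻ (adj? G v) {xs = allFin n} (subst (z ∈_) (sym eq) (there (here refl))))

-- Connected graphs without a vertex of degree three

Fork : FinGraph n → Fin n → Set
Fork G r = ∃ λ a → ∃ λ b → ∃ λ c →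
  Adj G r a × Adj G r b × Adj G r c × a ≢ b × a ≢ c × b ≢ c

fork? : (G : FinGraph n) → Dec (∃ (Fork G))
fork? G = any? λ r → any? λ a → any? λ b → any? λ c →
  adj? G r a ×-dec adj? G r b ×-dec adj? G r c
  ×-dec ¬? (a ≟ b) ×-dec ¬? (a ≟ c) ×-dec ¬? (b ≟ c)

module Forkless (G : FinGraph n) (4≤n : 4 ≤ n) (conn : Connected G)
  (cutless : ∀ a b → ¬ NonTrivialCutEdge G a b) (forkless : ¬ ∃ (Fork G)) where

  third : ∀ {r a b c} → Adj G r a → Adj G r b → a ≢ b → Adj G r c → c ≡ a ⊎ c ≡ b
  third {r} {a} {b} {c} ra rb a≢b rc with c ≟ a | c ≟ b
  ... | yes c≡a | _ = inj₁ c≡a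
  ... | no _ | yes c≡b = inj₂ c≡b
  ... | no c≢a | no c≢b =
    contradiction (r , a , b , c , ra , rb , rc , a≢b , ≢-sym c≢a , ≢-sym c≢b) forkless

  -- Without a fork at `q`, its neighbours are `p` and `u` only; so nothing leads out of the leaf
  -- `p` and `q` once the edge from `q` to `u` is deleted.
  pendant-path-cut : ∀ {p q u} → (∀ {y} → Adj G p y → y ≡ q) → Adj G p q → Adj G q u → p ≢ u →
    ¬ Connected (deleteEdge G q u)
  pendant-path-cut {p} {q} {u} leaf pq qu p≢u conn′ =
    leave (crossing-edge (deleteEdge G q u) (_∈? (p ∷ q ∷ [])) (here refl) u∉
      (walk (deleteEdge G q u) conn′ p u))
    where
    u∉ : u ∉ p ∷ q ∷ []
    u∉ (here u≡p) = p≢u (sym u≡p)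
    u∉ (there (here u≡q)) = irrefl G (sym u≡q) qu

    leave : ¬ (∃ λ x → ∃ λ y →
      x ∈ p ∷ q ∷ [] × Adj (deleteEdge G q u) x y × y ∉ p ∷ q ∷ [])
    leave (_ , _ , here refl , (xy , _) , y∉) = y∉ (there (here (leaf xy)))
    leave (_ , _ , there (here refl) , (xy , kept) , y∉) with third (symm G pq) qu p≢u xy
    ... | inj₁ y≡p = y∉ (here y≡p)
    ... | inj₂ y≡u = kept (inj₁ (refl , y≡u))

  -- From a leaf `p`, four vertices and connectedness give a path `p`, `q`, `u`, `z`. Then the edge
  -- from `q` to `u` is a cut edge, and both of its ends have a second neighbour.
  leafless : ∀ {p q} → Adj G p q → ∃ λ q′ → q′ ≢ q × Adj G p q′
  leafless {p} {q} pq with any? (λ q′ → ¬? (q′ ≟ q) ×-dec adj? G p q′)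
  ... | yes found = found
  ... | no none = contradiction beyond₁ λ where
      (_ , _ , here refl , pu , u∉) → u∉ (there (here (leaf pu)))
      (_ , u , there (here refl) , qu , u∉) →
        let p≢u : p ≢ u
            p≢u = λ p≡u → u∉ (here (sym p≡u))
        in contradiction (beyond₂ u) λ where
          (_ , _ , here refl , pz , z∉) → z∉ (there (here (leaf pz)))
          (_ , _ , there (here refl) , qz , z∉) → z∉ (outside (third (symm G pq) qu p≢u qz))
          (_ , z , there (there (here refl)) , uz , z∉) →
            cutless q u
              ((qu , pendant-path-cut leaf pq qu p≢u)
              , degree≢1 G (symm G pq) qu p≢u
              , degree≢1 G (symm G qu) uz λ { refl → z∉ (there (here refl)) })
    where
    leaf : ∀ {y} → Adj G p y → y ≡ q
    leaf {y} py = decidable-stable (y ≟ q) λ y≢q → none (y , y≢q , py)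

    beyond : ∀ xs → length (p ∷ xs) < n →
      ∃ λ x → ∃ λ y → x ∈ p ∷ xs × Adj G x y × y ∉ p ∷ xs
    beyond xs short with fresh (p ∷ xs) short
    ... | w , w∉ = crossing-edge G (_∈? (p ∷ xs)) (here refl) w∉ (walk G conn p w)

    beyond₁ = beyond (q ∷ []) (<-≤-trans (s≤s (s≤s (s≤s z≤n))) 4≤n)
    beyond₂ = λ u → beyond (q ∷ u ∷ []) 4≤n

    outside : ∀ {z u} → z ≡ p ⊎ z ≡ u → z ∈ p ∷ q ∷ u ∷ []
    outside (inj₁ refl) = here refl
    outside (inj₂ refl) = there (there (here refl))

  record Dart : Set where
    constructor dart
    field
      {source target} : Fin n
      edge : Adj G source target

  open Dart

  -- The walk never turns back: `leafless` provides a neighbour of the target other than the source.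
  advance : Dart → Dart
  advance (dart e) = dart (proj₂ (proj₂ (leafless (symm G e))))

  start : Dart
  start with w , w∉ ← fresh (fromℕ< (≤-trans (s≤s z≤n) 4≤n) ∷ []) (<-≤-trans (s≤s (s≤s z≤n)) 4≤n)
    with _ , _ , _ , e , _ ←
      crossing-edge G (_∈? (_ ∷ [])) (here refl) w∉ (walk G conn _ w) = dart e

  trail : ℕ → Dart
  trail zero = start
  trail (suc i) = advance (trail i)

  at : ℕ → Fin n
  at i = source (trail i)

  at-adj : ∀ i → Adj G (at i) (at (suc i))
  at-adj i = edge (trail i)

  at-turn : ∀ i → at (2 + i) ≢ at i
  at-turn i = proj₁ (proj₂ (leafless (symm G (edge (trail i)))))

  at-neighbour : ∀ i {x} → Adj G (at (suc i)) x → x ≡ at i ⊎ x ≡ at (2 + i)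
  at-neighbour i = third (symm G (at-adj i)) (at-adj (suc i)) (≢-sym (at-turn i))

  InjectiveBelow : ℕ → Set
  InjectiveBelow m = ∀ {i j} → i < m → j < m → at i ≡ at j → i ≡ j

  -- The vertex just before a return to `at (suc i)` is one of the two neighbours of that vertex,
  -- `at i` or `at (2 + i)`. Injectivity then leaves only a turn back or a loop.
  revisit-first : ∀ {m i} → InjectiveBelow m → i < m → at m ≡ at i → i ≡ 0
  revisit-first {i = zero} inj i<m eq = refl
  revisit-first {suc m} {suc i} inj i<m eq
    with at-neighbour i (subst (λ v → Adj G v (at m)) eq (symm G (at-adj m)))
  ... | inj₁ m≡i with refl ← inj (n<1+n m) (<⇒≤ i<m) m≡i = contradiction i<m (ℕ.<-irrefl refl)
  ... | inj₂ m≡2+i with m≤n⇒m<n∨m≡n i<m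
  ...   | inj₁ 2+i<1+m with refl ← inj (n<1+n m) 2+i<1+m m≡2+i = contradiction eq (at-turn (suc i))
  ...   | inj₂ refl = contradiction (at-adj (suc i)) (irrefl G m≡2+i)

  extend : ∀ {m} → InjectiveBelow m → (∀ {i} → i < m → at m ≢ at i) → InjectiveBelow (suc m)
  extend inj new (s≤s i≤m) (s≤s j≤m) eq with m≤n⇒m<n∨m≡n i≤m | m≤n⇒m<n∨m≡n j≤m
  ... | inj₁ i<m | inj₁ j<m = inj i<m j<m eq
  ... | inj₁ i<m | inj₂ refl = contradiction (sym eq) (new i<m)
  ... | inj₂ refl | inj₁ j<m = contradiction eq (new j<m)
  ... | inj₂ refl | inj₂ refl = refl

  below-injective : ∀ {m} → InjectiveBelow m → m ≤ n
  below-injective inj =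
    injective⇒≤ {f = at ∘ toℕ} λ {i} {j} eq → toℕ-injective (inj (toℕ<n i) (toℕ<n j) eq)

  -- More than `n` distinct vertices are impossible, so the trail repeats a vertex, and the first
  -- repetition is at its start.
  closes : ∃ λ m → InjectiveBelow m × 0 < m × at m ≡ at 0
  closes = go n 1 (≤-reflexive (ℕ.+-comm 1 n)) (s≤s z≤n) λ { (s≤s z≤n) (s≤s z≤n) _ → refl }
    where
    go : ∀ fuel m → n < fuel + m → 0 < m → InjectiveBelow m →
      ∃ λ m → InjectiveBelow m × 0 < m × at m ≡ at 0
    go zero m n<m _ inj = contradiction (below-injective inj) (<⇒≱ n<m)
    go (suc fuel) m n<1+fuel+m 0<m inj with anyUpTo? (λ i → at m ≟ at i) m
    ... | yes (i , i<m , eq) with refl ← revisit-first inj i<m eq = m , inj , 0<m , eq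
    ... | no new = go fuel (suc m) (subst (n <_) (sym (+-suc fuel m)) n<1+fuel+m) (s≤s z≤n)
      (extend inj λ i<m eq → new (_ , i<m , eq))

  module Closed (m : ℕ) (inj : InjectiveBelow (3 + m)) (closed : at (3 + m) ≡ at 0) where

    Next : ℕ → ℕ → Set
    Next i j = suc i ≡ j ⊎ (suc i ≡ 3 + m × j ≡ 0)

    next-adj : ∀ {i j} → Next i j → Adj G (at i) (at j)
    next-adj {i} (inj₁ refl) = at-adj i
    next-adj {i} (inj₂ (refl , refl)) = subst (Adj G (at i)) closed (at-adj i)

    neighbour : ∀ {i x} → i < 3 + m → Adj G (at i) x →
      ∃ λ j → j < 3 + m × at j ≡ x × (Next i j ⊎ Next j i)
    neighbour {zero} _ e
      -- The closing edge makes `at (2 + m)` the second neighbour of `at 0`.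
      with third (at-adj 0) (symm G (next-adj (inj₂ (refl , refl))))
             (λ eq → ℕ.1+n≢0 (ℕ.suc-injective (sym (inj (s≤s (s≤s z≤n)) (n<1+n _) eq)))) e
    ... | inj₁ x≡ = 1 , s≤s (s≤s z≤n) , sym x≡ , inj₁ (inj₁ refl)
    ... | inj₂ x≡ = 2 + m , n<1+n _ , sym x≡ , inj₂ (inj₂ (refl , refl))
    neighbour {suc i} i<m e with at-neighbour i e
    ... | inj₁ x≡ = i , <⇒≤ i<m , sym x≡ , inj₂ (inj₁ refl)
    ... | inj₂ x≡ with m≤n⇒m<n∨m≡n i<m
    ...   | inj₁ 2+i<m = 2 + i , 2+i<m , sym x≡ , inj₁ (inj₁ refl)
    ...   | inj₂ refl = 0 , s≤s z≤n , sym (trans x≡ closed) , inj₁ (inj₂ (refl , refl))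

    -- The closed trail contains all neighbours of its vertices, so no walk from `at 0` leaves it.
    covers : ∀ v → ∃ λ i → i < 3 + m × at i ≡ v
    covers v = follow (s≤s z≤n) (walk G conn (at 0) v)
      where
      follow : ∀ {i} → i < 3 + m → Star (Adj G) (at i) v → ∃ λ i → i < 3 + m × at i ≡ v
      follow i<m ε = _ , i<m , refl
      follow i<m (e ◅ es) with neighbour i<m e
      ... | j , j<m , refl , _ = follow j<m es

    position : Fin n → Fin (3 + m)
    position v = fromℕ< (proj₁ (proj₂ (covers v)))

    at-position : ∀ v → at (toℕ (position v)) ≡ v
    at-position v with _ , i<m , eq ← covers v = trans (cong at (toℕ-fromℕ< i<m)) eq

    isomorphic : (3≤n : 3 ≤ n) → G ≅ cycle n 3≤n
    -- The injections `at` and `position` in opposite directions force `n ≡ 3 + m`.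
    isomorphic 3≤n with refl ← ≤-antisym (below-injective inj)
        (injective⇒≤ {f = position} λ {u} {v} eq →
          trans (sym (at-position u)) (trans (cong (at ∘ toℕ) eq) (at-position v))) =
      permutation position (at ∘ toℕ)
        (λ i → toℕ-injective (inj (toℕ<n _) (toℕ<n i) (at-position _))) at-position
      , λ u v → mk⇔ (to u v) (from u v)
      where
      to : ∀ u v → Adj G u v → Adj (cycle n 3≤n) (position u) (position v)
      to u v uv
        with j , j<m , atj≡v , e ← neighbour (toℕ<n (position u))
          (subst (λ w → Adj G w v) (sym (at-position u)) uv)
        with refl ← inj j<m (toℕ<n (position v)) (trans atj≡v (sym (at-position v))) = e

      from : ∀ u v → Adj (cycle n 3≤n) (position u) (position v) → Adj G u v
      from u v e = subst₂ (Adj G) (at-position u) (at-position v) (adj e)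
        where
        adj : ∀ {i j} → Next i j ⊎ Next j i → Adj G (at i) (at j)
        adj (inj₁ next) = next-adj next
        adj (inj₂ next) = symm G (next-adj next)

  forkless⇒cycle : (3≤n : 3 ≤ n) → G ≅ cycle n 3≤n
  forkless⇒cycle 3≤n with closes
  -- Closed trails of length one and two would be a loop and a turn back.
  ... | 1 , _ , _ , eq = contradiction (at-adj 0) (irrefl G (sym eq))
  ... | 2 , _ , _ , eq = contradiction eq (at-turn 0)
  ... | suc (suc (suc m)) , inj , _ , eq = Closed.isomorphic m inj eq 3≤n

-- Exchanging tokens

remaining-token : {x : Fin (2 + k)} → x ≢ A → x ≢ B → blank x ≡ false
remaining-token {x = A} x≢A _ = contradiction refl x≢A
remaining-token {x = B} _ x≢B = contradiction refl x≢B
remaining-token {x = suc (suc _)} _ _ = refl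

module Exchange {k : ℕ} (Y : FinGraph (2 + k)) where

  open Reach Y public

  private
    variable
      S : List Vertex
      σ τ υ : State
      w x y : Fin (2 + k)

  -- Agreement outside `S`, told label by label: in this form it composes, and passes to larger
  -- sets, without deciding membership in `S`.
  record Agree (S : List Vertex) (σ τ : State) : Set where
    constructor agreeing
    field agree : ∀ l → σ ⟨$⟩ʳ l ≡ τ ⟨$⟩ʳ l ⊎ (σ ⟨$⟩ʳ l ∈ S × τ ⟨$⟩ʳ l ∈ S)

  open Agree public

  agree-refl : Agree S σ σ
  agree-refl = agreeing λ _ → inj₁ refl

  agree-∈ : Agree S σ τ → σ ⟨$⟩ʳ x ∈ S → τ ⟨$⟩ʳ x ∈ S
  agree-∈ {S} {x = x} (agreeing p) σx∈ with p x
  ... | inj₁ eq = subst (_∈ S) eq σx∈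
  ... | inj₂ (_ , τx∈) = τx∈

  agree-sym : Agree S σ τ → Agree S τ σ
  agree-sym {σ = σ} {τ} (agreeing p) = agreeing λ l → flip (p l)
    where
    flip : ∀ {a b : Vertex} → a ≡ b ⊎ (a ∈ S × b ∈ S) → b ≡ a ⊎ (b ∈ S × a ∈ S)
    flip (inj₁ eq) = inj₁ (sym eq)
    flip (inj₂ (a∈ , b∈)) = inj₂ (b∈ , a∈)

  agree-trans : Agree S σ τ → Agree S τ υ → Agree S σ υ
  agree-trans {S} {σ} {τ} {υ} p q = agreeing compose
    where
    compose : ∀ l → σ ⟨$⟩ʳ l ≡ υ ⟨$⟩ʳ l ⊎ (σ ⟨$⟩ʳ l ∈ S × υ ⟨$⟩ʳ l ∈ S)
    compose l with agree p l
    ... | inj₂ (σl∈ , τl∈) = inj₂ (σl∈ , agree-∈ q τl∈)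
    ... | inj₁ σl≡τl with agree q l
    ...   | inj₁ τl≡υl = inj₁ (trans σl≡τl τl≡υl)
    ...   | inj₂ (τl∈ , υl∈) = inj₂ (subst (_∈ S) (sym σl≡τl) τl∈ , υl∈)

  agree-there : Agree S σ τ → Agree (w ∷ S) σ τ
  agree-there {S} {σ} {τ} {w} p = agreeing λ l → weaken (agree p l)
    where
    weaken : ∀ {a b : Vertex} → a ≡ b ⊎ (a ∈ S × b ∈ S) → a ≡ b ⊎ (a ∈ w ∷ S × b ∈ w ∷ S)
    weaken (inj₁ eq) = inj₁ eq
    weaken (inj₂ (a∈ , b∈)) = inj₂ (there a∈ , there b∈)

  agree-⇄ : ∀ (σ : State) x y → σ ⟨$⟩ʳ x ∈ S → σ ⟨$⟩ʳ y ∈ S → Agree S σ (σ [ x ⇄ y ])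
  agree-⇄ {S} σ x y σx∈ σy∈ = agreeing compare
    where
    compare : ∀ l → σ ⟨$⟩ʳ l ≡ σ [ x ⇄ y ] ⟨$⟩ʳ l ⊎ (σ ⟨$⟩ʳ l ∈ S × σ [ x ⇄ y ] ⟨$⟩ʳ l ∈ S)
    compare l with l ≟ x
    ... | yes refl = inj₂ (σx∈ , subst (_∈ S) (sym (⇄-first σ x y)) σy∈)
    ... | no l≢x with l ≟ y
    ...   | yes refl = inj₂ (σy∈ , subst (_∈ S) (sym (⇄-second σ x y)) σx∈)
    ...   | no l≢y = inj₁ (sym (⇄-other σ l≢x l≢y))

  BlanksIn : List Vertex → State → Set
  BlanksIn S σ = σ ⟨$⟩ʳ A ∈ S × σ ⟨$⟩ʳ B ∈ S

  agree-blanks : Agree S σ τ → BlanksIn S σ → BlanksIn S τ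
  agree-blanks p (a∈ , b∈) = agree-∈ p a∈ , agree-∈ p b∈

  -- Written as an exchange with the occupant of the vertex, so that it is literally the result of a
  -- `move` when a blank steps there.
  place : State → Label → Vertex → State
  place σ x p = σ [ x ⇄ σ ⟨$⟩ˡ p ]

  place-at : ∀ (σ : State) x p → place σ x p ⟨$⟩ʳ x ≡ p
  place-at σ x p = trans (⇄-first σ x _) (inverseʳ σ)

  occupant-≢ : ∀ (σ : State) {p} → σ ⟨$⟩ʳ y ≢ p → y ≢ σ ⟨$⟩ˡ p
  occupant-≢ σ σy≢p refl = σy≢p (inverseʳ σ)

  occupant-token : ∀ (σ : State) {p} → σ ⟨$⟩ʳ A ≢ p → σ ⟨$⟩ʳ B ≢ p → blank (σ ⟨$⟩ˡ p) ≡ false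
  occupant-token σ A≢ B≢ = remaining-token (≢-sym (occupant-≢ σ A≢)) (≢-sym (occupant-≢ σ B≢))

  place-other : ∀ (σ : State) {x p} → y ≢ x → σ ⟨$⟩ʳ y ≢ p → place σ x p ⟨$⟩ʳ y ≡ σ ⟨$⟩ʳ y
  place-other σ y≢x σy≢p = ⇄-other σ y≢x (occupant-≢ σ σy≢p)

  place-agree : ∀ (σ : State) {x p} → σ ⟨$⟩ʳ x ∈ S → p ∈ S → Agree S σ (place σ x p)
  place-agree {S} σ {x} σx∈ p∈ = agree-⇄ σ x _ σx∈ (subst (_∈ S) (sym (inverseʳ σ)) p∈)

  -- A later placement affects only its own label and the occupant of its target, and neither has
  -- been settled before.
  place₃ : ∀ (σ : State) {x y z p q s} → x ≢ y → x ≢ z → y ≢ z → p ≢ q → p ≢ s → q ≢ s →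
    σ ⟨$⟩ʳ x ∈ S → σ ⟨$⟩ʳ y ∈ S → σ ⟨$⟩ʳ z ∈ S → p ∈ S → q ∈ S → s ∈ S →
    ∃[ τ ] (τ ⟨$⟩ʳ x ≡ p × τ ⟨$⟩ʳ y ≡ q × τ ⟨$⟩ʳ z ≡ s × Agree S σ τ)
  place₃ {S} σ {x} {y} {z} {p} {q} {s} x≢y x≢z y≢z p≢q p≢s q≢s σx∈ σy∈ σz∈ p∈ q∈ s∈ =
    σ₃
    , trans (place-other σ₂ x≢z λ eq → p≢s (trans (sym σ₂x) eq)) σ₂x
    , trans (place-other σ₂ y≢z λ eq → q≢s (trans (sym σ₂y) eq)) σ₂y
    , place-at σ₂ z s
    , agree-trans agree₂ (place-agree σ₂ (agree-∈ agree₂ σz∈) s∈)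
    where
    σ₁ = place σ x p
    σ₂ = place σ₁ y q
    σ₃ = place σ₂ z s

    agree₁ : Agree S σ σ₁
    agree₁ = place-agree σ σx∈ p∈

    agree₂ : Agree S σ σ₂
    agree₂ = agree-trans agree₁ (place-agree σ₁ (agree-∈ agree₁ σy∈) q∈)

    σ₂x : σ₂ ⟨$⟩ʳ x ≡ p
    σ₂x = trans (place-other σ₁ x≢y λ eq → p≢q (trans (sym (place-at σ x p)) eq)) (place-at σ x p)

    σ₂y : σ₂ ⟨$⟩ʳ y ≡ q
    σ₂y = place-at σ₁ y q

  -- The blanks advance like a train: `α` steps onto the place of the token `m`, `β` follows into
  -- the place of `α`, and `m` ends up behind them.
  record Slide (σ : State) (α β m : Label) : Set where
    field
      {result} : State
      reached  : σ ~ result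
      at-α     : result ⟨$⟩ʳ α ≡ σ ⟨$⟩ʳ m
      at-β     : result ⟨$⟩ʳ β ≡ σ ⟨$⟩ʳ α
      at-m     : result ⟨$⟩ʳ m ≡ σ ⟨$⟩ʳ β
      at-other : ∀ {z} → z ≢ α → z ≢ β → z ≢ m → result ⟨$⟩ʳ z ≡ σ ⟨$⟩ʳ z

    slide-agree : ∀ {S} → σ ⟨$⟩ʳ α ∈ S → σ ⟨$⟩ʳ β ∈ S → σ ⟨$⟩ʳ m ∈ S → Agree S σ result
    slide-agree {S} α∈ β∈ m∈ = agreeing compare
      where
      compare : ∀ l → σ ⟨$⟩ʳ l ≡ result ⟨$⟩ʳ l ⊎ (σ ⟨$⟩ʳ l ∈ S × result ⟨$⟩ʳ l ∈ S)
      compare l with l ≟ α | l ≟ β | l ≟ m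
      ... | yes refl | _ | _ = inj₂ (α∈ , subst (_∈ S) (sym at-α) m∈)
      ... | no _ | yes refl | _ = inj₂ (β∈ , subst (_∈ S) (sym at-β) α∈)
      ... | no _ | no _ | yes refl = inj₂ (m∈ , subst (_∈ S) (sym at-m) β∈)
      ... | no l≢α | no l≢β | no l≢m = inj₁ (sym (at-other l≢α l≢β l≢m))

  slide : ∀ (σ : State) {α β m} → blank α ≡ true → blank β ≡ true → α ≢ β → blank m ≡ false →
    Adj Y (σ ⟨$⟩ʳ α) (σ ⟨$⟩ʳ β) → Adj Y (σ ⟨$⟩ʳ α) (σ ⟨$⟩ʳ m) → Slide σ α β m
  slide σ {α} {β} {m} bα bβ α≢β tm αβ αm = record
    { reached  = ~-trans (move σ bα tm αm)
                   (move σ₁ bβ tm (subst₂ (Adj Y) (sym σ₁β) (sym σ₁m) (symm Y αβ)))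
    ; at-α     = trans (⇄-other σ₁ α≢β α≢m) (⇄-first σ α m)
    ; at-β     = trans (⇄-first σ₁ β m) σ₁m
    ; at-m     = trans (⇄-second σ₁ β m) σ₁β
    ; at-other = λ z≢α z≢β z≢m → trans (⇄-other σ₁ z≢β z≢m) (⇄-other σ z≢α z≢m)
    }
    where
    σ₁ = σ [ α ⇄ m ]
    α≢m = ≢-sym (token≢blank bα tm)
    β≢m = ≢-sym (token≢blank bβ tm)

    σ₁β : σ₁ ⟨$⟩ʳ β ≡ σ ⟨$⟩ʳ β
    σ₁β = ⇄-other σ (≢-sym α≢β) β≢m

    σ₁m : σ₁ ⟨$⟩ʳ m ≡ σ ⟨$⟩ʳ α
    σ₁m = ⇄-second σ α m

  Exchangeable : List Vertex → Set
  Exchangeable S = ∀ {σ τ} → BlanksIn S σ → BlanksIn S τ → Agree S σ τ → σ ≈ τ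

  module Cherry {r a b : Vertex} (ra : Adj Y r a) (rb : Adj Y r b) (a≢b : a ≢ b) where

    private
      S₀ : List Vertex
      S₀ = r ∷ a ∷ b ∷ []

      r∈ : r ∈ S₀
      r∈ = here refl

      a∈ : a ∈ S₀
      a∈ = there (here refl)

      b∈ : b ∈ S₀
      b∈ = there (there (here refl))

    -- A normal form: with the blanks at `r` and `a`, only `b` remains for the third label of the
    -- path. Hence normal forms of states that agree outside `S₀` coincide.
    Canonical : State → Set
    Canonical σ = ∃[ ρ ] (σ ≈ ρ × ρ ⟨$⟩ʳ A ≡ r × ρ ⟨$⟩ʳ B ≡ a × Agree S₀ σ ρ)

    via : σ ≈ τ → Agree S₀ σ τ → Canonical τ → Canonical σ
    via σ≈τ p (ρ , τ≈ρ , ρA , ρB , q) = ρ , ≈-trans σ≈τ τ≈ρ , ρA , ρB , agree-trans p q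

    via-twist : ∀ (σ : State) → BlanksIn S₀ σ → Canonical (σ [ A ⇄ B ]) → Canonical σ
    via-twist σ (A∈ , B∈) = via (≈-twist σ) (agree-⇄ σ A B A∈ B∈)

    canonical-ra : ∀ (σ : State) → σ ⟨$⟩ʳ A ≡ r → σ ⟨$⟩ʳ B ≡ a → Canonical σ
    canonical-ra σ σA σB = σ , ~⇒≈ ~-refl , σA , σB , agree-refl

    canonical-ar : ∀ (σ : State) → σ ⟨$⟩ʳ A ≡ a → σ ⟨$⟩ʳ B ≡ r → Canonical σ
    canonical-ar σ refl refl =
      via-twist σ (a∈ , r∈) (canonical-ra _ (⇄-first σ A B) (⇄-second σ A B))

    canonical-rb : ∀ (σ : State) → σ ⟨$⟩ʳ A ≡ r → σ ⟨$⟩ʳ B ≡ b → Canonical σ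
    canonical-rb σ refl refl =
      -- `A` steps from `r` to `a` and `B` follows from `b` to `r`.
      via (~⇒≈ reached) (slide-agree r∈ b∈ (subst (_∈ S₀) (sym (inverseʳ σ)) a∈))
        (canonical-ar result (trans at-α (inverseʳ σ)) at-β)
      where
      moved : Slide σ A B (σ ⟨$⟩ˡ a)
      moved = slide σ refl refl (λ ()) (occupant-token σ (λ eq → irrefl Y eq ra) (≢-sym a≢b))
        rb (subst (Adj Y _) (sym (inverseʳ σ)) ra)

      open Slide moved

    canonical-br : ∀ (σ : State) → σ ⟨$⟩ʳ A ≡ b → σ ⟨$⟩ʳ B ≡ r → Canonical σ
    canonical-br σ refl refl =
      via-twist σ (b∈ , r∈) (canonical-rb _ (⇄-first σ A B) (⇄-second σ A B))

    canonical-ab : ∀ (σ : State) → σ ⟨$⟩ʳ A ≡ a → σ ⟨$⟩ʳ B ≡ b → Canonical σ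
    canonical-ab σ refl refl =
      via (~⇒≈ (move σ refl t (subst (Adj Y b) (sym (inverseʳ σ)) (symm Y rb))))
        (place-agree σ b∈ r∈)
        (canonical-ar (place σ B r)
          (place-other σ {x = B} (λ ()) λ eq → irrefl Y (sym eq) ra) (place-at σ B r))
      where
      t : blank (σ ⟨$⟩ˡ r) ≡ false
      t = occupant-token σ (λ eq → irrefl Y (sym eq) ra) (λ eq → irrefl Y (sym eq) rb)

    canonical-ba : ∀ (σ : State) → σ ⟨$⟩ʳ A ≡ b → σ ⟨$⟩ʳ B ≡ a → Canonical σ
    canonical-ba σ refl refl =
      via-twist σ (b∈ , a∈) (canonical-ab _ (⇄-first σ A B) (⇄-second σ A B))

    canonical : ∀ (σ : State) → BlanksIn S₀ σ → Canonical σ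
    canonical σ (here p , here q) = contradiction (trans p (sym q)) (distinct σ λ ())
    canonical σ (here p , there (here q)) = canonical-ra σ p q
    canonical σ (here p , there (there (here q))) = canonical-rb σ p q
    canonical σ (there (here p) , here q) = canonical-ar σ p q
    canonical σ (there (here p) , there (here q)) =
      contradiction (trans p (sym q)) (distinct σ λ ())
    canonical σ (there (here p) , there (there (here q))) = canonical-ab σ p q
    canonical σ (there (there (here p)) , here q) = canonical-br σ p q
    canonical σ (there (there (here p)) , there (here q)) = canonical-ba σ p q
    canonical σ (there (there (here p)) , there (there (here q))) =
      contradiction (trans p (sym q)) (distinct σ λ ())

    third-place : ∀ (σ : State) → σ ⟨$⟩ʳ A ≡ r → σ ⟨$⟩ʳ B ≡ a → ∀ {l} → l ≢ A → l ≢ B →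
      σ ⟨$⟩ʳ l ∈ S₀ → σ ⟨$⟩ʳ l ≡ b
    third-place σ σA σB l≢A l≢B (here p) = contradiction (trans p (sym σA)) (distinct σ l≢A)
    third-place σ σA σB l≢A l≢B (there (here p)) = contradiction (trans p (sym σB)) (distinct σ l≢B)
    third-place σ σA σB l≢A l≢B (there (there (here p))) = p

    exchangeable : Exchangeable S₀
    exchangeable {σ} {τ} σ∈ τ∈ p
      with ρ , σ≈ρ , ρA , ρB , q ← canonical σ σ∈
      with ρ′ , τ≈ρ′ , ρ′A , ρ′B , q′ ← canonical τ τ∈ =
      ≈-trans σ≈ρ (≈-trans (~⇒≈ (≐⇒~ (pointwise same))) (≈-sym τ≈ρ′))
      where
      same : ∀ l → ρ ⟨$⟩ʳ l ≡ ρ′ ⟨$⟩ʳ l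
      same A = trans ρA (sym ρ′A)
      same B = trans ρB (sym ρ′B)
      same l@(suc (suc _)) with agree (agree-trans (agree-sym q) (agree-trans p q′)) l
      ... | inj₁ eq = eq
      ... | inj₂ (∈₁ , ∈₂) = trans (third-place ρ ρA ρB (λ ()) (λ ()) ∈₁)
                               (sym (third-place ρ′ ρ′A ρ′B (λ ()) (λ ()) ∈₂))

-- Enlarging an exchangeable set

module Growth {k : ℕ} (Y : FinGraph (2 + k)) where

  open Exchange Y public

  private
    variable
      S : List Vertex

  Loadable : List Vertex → Vertex → Set
  Loadable S w = ∀ (σ : State) {t} → BlanksIn S σ → blank t ≡ false → σ ⟨$⟩ʳ t ∈ S →
    ∃[ τ ] (σ ≈ τ × τ ⟨$⟩ʳ t ≡ w × BlanksIn S τ × Agree (w ∷ S) σ τ)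

  module Absorb {S : List Vertex} {u v w : Vertex} (u∈ : u ∈ S) (v∈ : v ∈ S) (w∉ : w ∉ S)
    (vu : Adj Y v u) (vw : Adj Y v w) where

    private
      ≢w : ∀ {x} → x ∈ S → x ≢ w
      ≢w x∈ refl = w∉ x∈

      Retract : State → Set
      Retract σ = ∃[ τ ] (σ ≈ τ × BlanksIn S τ × Agree (w ∷ S) σ τ)

    -- The blank at `w` steps to `v`; if the other blank is there, that one first steps aside to
    -- `u`. The blanks are called `α` and `β` so that either of them may be the one at `w`.
    retract-from-w : ∀ {α β} → blank α ≡ true → blank β ≡ true → α ≢ β →
      (∀ {x} → x ≢ α → x ≢ β → blank x ≡ false) →
      ∀ (σ : State) → σ ⟨$⟩ʳ α ≡ w → σ ⟨$⟩ʳ β ∈ S →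
      ∃[ τ ] (σ ~ τ × τ ⟨$⟩ʳ α ∈ S × τ ⟨$⟩ʳ β ∈ S × Agree (w ∷ S) σ τ)
    retract-from-w {α} {β} bα bβ α≢β token σ σα≡w σβ∈ = retract
      where
      into-S : ∀ (σ : State) → σ ⟨$⟩ʳ α ≡ w → σ ⟨$⟩ʳ β ∈ S → σ ⟨$⟩ʳ β ≢ v →
        ∃[ τ ] (σ ~ τ × τ ⟨$⟩ʳ α ∈ S × τ ⟨$⟩ʳ β ∈ S × Agree (w ∷ S) σ τ)
      into-S σ σα≡w σβ∈ σβ≢v =
        place σ α v
        , move σ bα (token (≢-sym (occupant-≢ σ λ eq → ≢w v∈ (trans (sym eq) σα≡w)))
                           (≢-sym (occupant-≢ σ σβ≢v)))
            (subst₂ (Adj Y) (sym σα≡w) (sym (inverseʳ σ)) (symm Y vw))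
        , subst (_∈ S) (sym (place-at σ α v)) v∈
        , subst (_∈ S) (sym (place-other σ {x = α} (≢-sym α≢β) σβ≢v)) σβ∈
        , place-agree σ (here σα≡w) (there v∈)

      retract : ∃[ τ ] (σ ~ τ × τ ⟨$⟩ʳ α ∈ S × τ ⟨$⟩ʳ β ∈ S × Agree (w ∷ S) σ τ)
      retract with σ ⟨$⟩ʳ β ≟ v
      ... | no σβ≢v = into-S σ σα≡w σβ∈ σβ≢v
      ... | yes σβ≡v
        with τ , σ₁~τ , τα∈ , τβ∈ , p ←
          into-S (place σ β u)
            (trans (place-other σ {x = β} α≢β λ eq → ≢w u∈ (trans (sym eq) σα≡w)) σα≡w)
            (subst (_∈ S) (sym (place-at σ β u)) u∈)
            (λ eq → irrefl Y (trans (sym eq) (place-at σ β u)) vu) =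
        τ
        , ~-trans (move σ bβ
            (token (≢-sym (occupant-≢ σ λ eq → ≢w u∈ (trans (sym eq) σα≡w)))
                   (≢-sym (occupant-≢ σ λ eq → irrefl Y (trans (sym σβ≡v) eq) vu)))
            (subst₂ (Adj Y) (sym σβ≡v) (sym (inverseʳ σ)) vu)) σ₁~τ
        , τα∈ , τβ∈
        , agree-trans (place-agree σ (there σβ∈) (there u∈)) p

    retract : ∀ (σ : State) → BlanksIn (w ∷ S) σ → Retract σ
    retract σ (here p , here q) = contradiction (trans p (sym q)) (distinct σ λ ())
    retract σ (here p , there q)
      with τ , σ~τ , τA∈ , τB∈ , agr ← retract-from-w refl refl (λ ()) remaining-token σ p q =
      τ , ~⇒≈ σ~τ , (τA∈ , τB∈) , agr
    retract σ (there p , here q)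
      with τ , σ~τ , τB∈ , τA∈ , agr ←
        retract-from-w refl refl (λ ()) (λ x≢B x≢A → remaining-token x≢A x≢B) σ q p =
      τ , ~⇒≈ σ~τ , (τA∈ , τB∈) , agr
    retract σ (there p , there q) = σ , ~⇒≈ ~-refl , (p , q) , agree-refl

    -- As `t` occupies `w` in both states, every other label that differs has both its places in
    -- `S`.
    narrow : ∀ {σ τ t} → σ ⟨$⟩ʳ t ≡ w → τ ⟨$⟩ʳ t ≡ w → Agree (w ∷ S) σ τ → Agree S σ τ
    narrow {σ} {τ} {t} σt τt p = agreeing compare
      where
      compare : ∀ l → σ ⟨$⟩ʳ l ≡ τ ⟨$⟩ʳ l ⊎ (σ ⟨$⟩ʳ l ∈ S × τ ⟨$⟩ʳ l ∈ S)
      compare l with agree p l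
      ... | inj₁ eq = inj₁ eq
      ... | inj₂ (here σl , _)
        with refl ← injective σ (trans σl (sym σt)) = inj₁ (trans σt (sym τt))
      ... | inj₂ (there _ , here τl)
        with refl ← injective τ (trans τl (sym τt)) = inj₁ (trans σt (sym τt))
      ... | inj₂ (there σl∈ , there τl∈) = inj₂ (σl∈ , τl∈)

    -- After both states have been retracted, the label `t` at `w` in the second is a token. It is
    -- loaded to `w` in the first unless it is there already, and what still differs lies within
    -- `S`.
    absorb : Exchangeable S → Loadable S w → Exchangeable (w ∷ S)
    absorb exch load {σ} {τ} σ∈ τ∈ p
      with σ′ , σ≈σ′ , σ′∈ , q ← retract σ σ∈
      with τ′ , τ≈τ′ , τ′∈ , q′ ← retract τ τ∈ =
      ≈-trans σ≈σ′ (≈-trans (compare (agree-∈ (agree-sym p′) (here τ′t≡w))) (≈-sym τ≈τ′))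
      where
      t : Label
      t = τ′ ⟨$⟩ˡ w

      τ′t≡w : τ′ ⟨$⟩ʳ t ≡ w
      τ′t≡w = inverseʳ τ′

      p′ : Agree (w ∷ S) σ′ τ′
      p′ = agree-trans (agree-sym q) (agree-trans p q′)

      compare : σ′ ⟨$⟩ʳ t ∈ w ∷ S → σ′ ≈ τ′
      compare (here σ′t≡w) = exch σ′∈ τ′∈ (narrow σ′t≡w τ′t≡w p′)
      compare (there σ′t∈)
        with σ″ , σ′≈σ″ , σ″t≡w , σ″∈ , r ←
          load σ′ σ′∈ (occupant-token τ′ (≢w (proj₁ τ′∈)) (≢w (proj₂ τ′∈))) σ′t∈ =
        ≈-trans σ′≈σ″
          (exch σ″∈ τ′∈ (narrow σ″t≡w τ′t≡w (agree-trans (agree-sym r) p′)))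

  module _ {S : List Vertex} {v w : Vertex} (exch : Exchangeable S)
    (v∈ : v ∈ S) (w∉ : w ∉ S) (vw : Adj Y v w) where

    private
      ≢w : ∀ {x} → x ∈ S → x ≢ w
      ≢w x∈ refl = w∉ x∈

    -- Both blanks pass through v: the first parks at w, the second carries the
    -- old content of w to b, and then t goes from a through v to w.

    load-from-two : ∀ {a b} → a ∈ S → b ∈ S → a ≢ b → Adj Y v a → Adj Y v b → Loadable S w
    load-from-two {a} {b} a∈ b∈ a≢b va vb σ {t} σ∈ token-t t∈
      with τ , τA , τB , τt , p ← place₃ σ {A} {B} {t} {v} {b} {a} (λ ())
             (≢-sym (token≢blank refl token-t)) (≢-sym (token≢blank refl token-t))
             (λ eq → irrefl Y eq vb) (λ eq → irrefl Y eq va) (≢-sym a≢b)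
             (proj₁ σ∈) (proj₂ σ∈) t∈ v∈ b∈ a∈ =
      S₂.result
      , ≈-trans (exch σ∈ (agree-blanks p σ∈) p) (~⇒≈ (~-trans S₁.reached S₂.reached))
      , trans S₂.at-m (trans S₁.at-α τx)
      , ( subst (_∈ S) (sym (trans S₂.at-β (trans S₁.at-β τA))) v∈
        , subst (_∈ S) (sym (trans S₂.at-α (trans S₁t τt))) a∈)
      , agree-trans (agree-there p)
          (agree-trans
            (S₁.slide-agree (there τA∈) (there τB∈) (here τx))
            (S₂.slide-agree (there (subst (_∈ S) (sym S₁.at-β) τA∈))
              (here (trans S₁.at-α τx)) (there (subst (_∈ S) (sym (trans S₁t τt)) a∈))))
      where
      x : Label
      x = τ ⟨$⟩ˡ w

      τx : τ ⟨$⟩ʳ x ≡ w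
      τx = inverseʳ τ

      τA∈ : τ ⟨$⟩ʳ A ∈ S
      τA∈ = subst (_∈ S) (sym τA) v∈

      τB∈ : τ ⟨$⟩ʳ B ∈ S
      τB∈ = subst (_∈ S) (sym τB) b∈

      slide₁ : Slide τ A B x
      slide₁ = slide τ refl refl (λ ()) (occupant-token τ (≢w τA∈) (≢w τB∈))
        (subst₂ (Adj Y) (sym τA) (sym τB) vb) (subst₂ (Adj Y) (sym τA) (sym τx) vw)

      module S₁ = Slide slide₁

      S₁t : S₁.result ⟨$⟩ʳ t ≡ τ ⟨$⟩ʳ t
      S₁t = S₁.at-other (token≢blank refl token-t) (token≢blank refl token-t)
        (distinct⁻ τ refl τx (≢w (subst (_∈ S) (sym τt) a∈)))

      slide₂ : Slide S₁.result B A t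
      slide₂ = slide S₁.result refl refl (λ ()) token-t
        (subst₂ (Adj Y) (sym (trans S₁.at-β τA)) (sym (trans S₁.at-α τx)) vw)
        (subst₂ (Adj Y) (sym (trans S₁.at-β τA)) (sym (trans S₁t τt)) va)

      module S₂ = Slide slide₂

  -- A walk that avoids `S` until it arrives at `v′`. It may revisit vertices outside `S`, since the
  -- blank that runs along it comes back the same way.
  data Ear (S : List Vertex) (v′ : Vertex) : Vertex → Set where
    arrive : Ear S v′ v′
    step   : ∀ {z z′} → z ∉ S → Adj Y z z′ → Ear S v′ z′ → Ear S v′ z

  module Conveyor {S : List Vertex} {v v′ r s : Vertex} (exch : Exchangeable S)
    (v∈ : v ∈ S) (v′∈ : v′ ∈ S) (r∈ : r ∈ S) (s∈ : s ∈ S)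
    (v≢v′ : v ≢ v′) (r≢v′ : r ≢ v′) (s≢v′ : s ≢ v′) where

    ear-avoids : ∀ {z x} → Ear S v′ z → x ∈ S → x ≢ v′ → x ≢ z
    ear-avoids arrive x∈ x≢v′ = x≢v′
    ear-avoids (step z∉ _ _) x∈ _ refl = z∉ x∈

    -- The walk of A to v′ and back conjugates an exchange inside S; as the
    -- walk never meets v and s, the conjugate is the same exchange.

    convey : ∀ {z x t} → blank x ≡ false → blank t ≡ false → Ear S v′ z → ∀ (σ : State) →
      σ ⟨$⟩ʳ A ≡ z → σ ⟨$⟩ʳ B ≡ r → σ ⟨$⟩ʳ x ≡ v → σ ⟨$⟩ʳ t ≡ s → σ ≈ σ [ x ⇄ t ]
    convey {x = x} {t} tx tt arrive σ σA σB σx σt =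
      exch σ∈ (agree-blanks swapped σ∈) swapped
      where
      σ∈ : BlanksIn S σ
      σ∈ = subst (_∈ S) (sym σA) v′∈ , subst (_∈ S) (sym σB) r∈

      swapped : Agree S σ (σ [ x ⇄ t ])
      swapped = agree-⇄ σ x t (subst (_∈ S) (sym σx) v∈) (subst (_∈ S) (sym σt) s∈)
    convey {z} {x} {t} tx tt (step {z′ = z′} z∉ zz′ ear) σ σA σB σx σt =
      ≈-trans (~⇒≈ σ~σ₁) (≈-trans
        (convey tx tt ear σ₁ (place-at σ A z′)
          (trans (place-other σ {x = A} (λ ()) (≢z′ r∈ r≢v′ σB)) σB)
          (trans (place-other σ (token≢blank refl tx) (≢z′ v∈ v≢v′ σx)) σx)
          (trans (place-other σ (token≢blank refl tt) (≢z′ s∈ s≢v′ σt)) σt))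
        (≈-sym (≈-relabel tx tt (~⇒≈ σ~σ₁))))
      where
      σ₁ = place σ A z′

      ≢z′ : ∀ {l p} → p ∈ S → p ≢ v′ → σ ⟨$⟩ʳ l ≡ p → σ ⟨$⟩ʳ l ≢ z′
      ≢z′ p∈ p≢v′ refl = ear-avoids ear p∈ p≢v′

      σ~σ₁ : σ ~ σ₁
      σ~σ₁ = move σ refl
        (occupant-token σ (λ eq → irrefl Y (trans (sym σA) eq) zz′) (≢z′ r∈ r≢v′ σB))
        (subst₂ (Adj Y) (sym σA) (sym (inverseʳ σ)) zz′)

    -- `A` steps from `v` to `w` and so brings the token `x` of `w` to `v`. There `convey` exchanges
    -- it with `t`, which waits at `s`. Undoing the step of `A`, with `x` and `t` renamed, carries
    -- `t` to `w`.
    load-along-ear : ∀ {w} → v ≢ r → v ≢ s → r ≢ s → w ∉ S → Adj Y v w → Ear S v′ w → Loadable S w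
    load-along-ear {w} v≢r v≢s r≢s w∉ vw ear σ {t} σ∈ token-t t∈
      with τ , τA , τB , τt , p ← place₃ σ {A} {B} {t} (λ ())
             (≢-sym (token≢blank refl token-t)) (≢-sym (token≢blank refl token-t))
             v≢r v≢s r≢s (proj₁ σ∈) (proj₂ σ∈) t∈ v∈ r∈ s∈ =
      τ [ x ⇄ t ]
      , ≈-trans (exch σ∈ (agree-blanks p σ∈) p)
          (≈-trans (~⇒≈ τ~τ₁) (≈-trans
            (convey token-x token-t ear τ₁ (place-at τ A w)
              (trans (place-other τ {x = A} (λ ()) (≢w r∈ τB)) τB)
              (trans (⇄-second τ A x) τA)
              (trans (place-other τ (token≢blank refl token-t) (≢w s∈ τt)) τt))
            (≈-sym (≈-relabel token-x token-t (~⇒≈ τ~τ₁)))))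
      , trans (⇄-second τ x t) τx
      , ( subst (_∈ S) (sym (trans (unmoved refl) τA)) v∈
        , subst (_∈ S) (sym (trans (unmoved refl) τB)) r∈)
      , agree-trans (agree-there p)
          (agree-⇄ τ x t (here τx) (there (subst (_∈ S) (sym τt) s∈)))
      where
      x : Label
      x = τ ⟨$⟩ˡ w

      τx : τ ⟨$⟩ʳ x ≡ w
      τx = inverseʳ τ

      ≢w : ∀ {l p} → p ∈ S → τ ⟨$⟩ʳ l ≡ p → τ ⟨$⟩ʳ l ≢ w
      ≢w p∈ refl refl = w∉ p∈

      token-x : blank x ≡ false
      token-x = occupant-token τ (≢w v∈ τA) (≢w r∈ τB)

      unmoved : ∀ {l} → blank l ≡ true → τ [ x ⇄ t ] ⟨$⟩ʳ l ≡ τ ⟨$⟩ʳ l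
      unmoved bl = ⇄-other τ (≢-sym (token≢blank bl token-x)) (≢-sym (token≢blank bl token-t))

      τ₁ = place τ A w

      τ~τ₁ : τ ~ τ₁
      τ~τ₁ = move τ refl token-x (subst₂ (Adj Y) (sym τA) (sym τx) vw)

-- Sufficiency of the conditions

module Sufficiency {k : ℕ} (Y : FinGraph (2 + k)) (conn : Connected Y)
  (cutless : ∀ a b → ¬ NonTrivialCutEdge Y a b) (nonbipartite : ¬ Bipartite Y)
  {r a b c : Fin (2 + k)} (ra : Adj Y r a) (rb : Adj Y r b) (rc : Adj Y r c)
  (a≢b : a ≢ b) (a≢c : a ≢ c) (b≢c : b ≢ c) where

  open Growth Y
  open _~[_]_

  private
    ra≢ : r ≢ a
    ra≢ eq = irrefl Y eq ra

    rb≢ : r ≢ b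
    rb≢ eq = irrefl Y eq rb

    rc≢ : r ≢ c
    rc≢ eq = irrefl Y eq rc

  four : List Vertex
  four = c ∷ r ∷ a ∷ b ∷ []

  unique-four : Unique four
  unique-four =
    (≢-sym rc≢ ∷ ≢-sym a≢c ∷ ≢-sym b≢c ∷ []) ∷ (ra≢ ∷ rb≢ ∷ []) ∷ (a≢b ∷ []) ∷ [] ∷ []

  -- This makes a step out of `S` at `v` possible: either `v` has two neighbours in `S`, or `u` is
  -- not a leaf, so that the edge from `v` to `u` cannot be a cut edge once `v` has a neighbour
  -- outside `S`.
  Anchored : List Vertex → Vertex → Set
  Anchored S v = ∃[ u ] (u ∈ S × Adj Y v u
    × (degree Y u ≢ 1 ⊎ ∃[ u′ ] (u′ ∈ S × u ≢ u′ × Adj Y v u′)))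

  record Grown (S : List Vertex) : Set where
    field
      exchangeable : Exchangeable S
      four⊆        : ∀ {x} → x ∈ four → x ∈ S
      anchored     : ∀ {x} → x ∈ S → Anchored S x

  open Grown

  anchored-there : ∀ {S v w} → Anchored S v → Anchored (w ∷ S) v
  anchored-there (u , u∈ , vu , inj₁ deg) = u , there u∈ , vu , inj₁ deg
  anchored-there (u , u∈ , vu , inj₂ (u′ , u′∈ , u≢u′ , vu′)) =
    u , there u∈ , vu , inj₂ (u′ , there u′∈ , u≢u′ , vu′)

  grown-four : Grown four
  grown-four = record
    { exchangeable = Absorb.absorb second∈ (here refl) c∉ ra rc cherry
        (load-from-two cherry (here refl) c∉ rc second∈ (there second∈) a≢b ra rb)
    ; four⊆ = λ x∈ → x∈
    ; anchored = λ where
        (here refl) → r , second∈ , symm Y rc , deg-r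
        (there (here refl)) → a , there second∈ , ra , inj₂ (b , there (there second∈) , a≢b , rb)
        (there (there (here refl))) → r , second∈ , symm Y ra , deg-r
        (there (there (there (here refl)))) → r , second∈ , symm Y rb , deg-r
    }
    where
    cherry = Cherry.exchangeable ra rb a≢b

    second∈ : ∀ {x y zs} → y ∈ x ∷ y ∷ zs
    second∈ = there (here refl)

    c∉ : c ∉ r ∷ a ∷ b ∷ []
    c∉ (here eq) = rc≢ (sym eq)
    c∉ (there (here eq)) = a≢c (sym eq)
    c∉ (there (there (here eq))) = b≢c (sym eq)

    deg-r : ∀ {P : Set} → degree Y r ≢ 1 ⊎ P
    deg-r = inj₁ (degree≢1 Y ra rb a≢b)

  absorb-neighbour : ∀ {S u v w} → Grown S → u ∈ S → Adj Y v u → v ∈ S → w ∉ S → Adj Y v w →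
    Loadable S w → Grown (w ∷ S)
  absorb-neighbour {S} {u} {v} {w} g u∈ vu v∈ w∉ vw load = record
    { exchangeable = Absorb.absorb u∈ v∈ w∉ vu vw (exchangeable g) load
    ; four⊆ = λ x∈ → there (four⊆ g x∈)
    ; anchored = λ where
        (here refl) → v , there v∈ , symm Y vw
          , inj₁ (degree≢1 Y vu vw λ { refl → w∉ u∈ })
        (there x∈) → anchored-there (anchored g x∈)
    }

  -- The ear is the part of the walk after its last visit to `v`, up to its next vertex in `S`. It
  -- begins outside `S`, because the edge to the only neighbour of `v` in `S` is deleted.
  find-ear : ∀ {S u v} → u ∈ S → v ∈ S → Adj Y v u → (∀ {y} → y ∈ S → Adj Y v y → y ≡ u) →
    Star (Adj (deleteEdge Y v u)) v u →
    ∃[ w ] (w ∉ S × Adj Y v w × ∃[ v′ ] (v′ ∈ S × v ≢ v′ × Ear S v′ w))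
  find-ear {S} {u} {v} u∈ v∈ vu only es with search es
    where
    EarFrom : Vertex → Set
    EarFrom z = ∃[ v′ ] (v′ ∈ S × v ≢ v′ × Ear S v′ z)

    -- The walk is processed from its end: `inj₁` holds the ear from the current vertex, restarted
    -- at each vertex of `S` other than `v`, and `inj₂` the ear found at the last departure from
    -- `v`.
    search : ∀ {z} → Star (Adj (deleteEdge Y v u)) z u →
      EarFrom z ⊎ ∃[ w ] (w ∉ S × Adj Y v w × EarFrom w)
    search ε = inj₁ (u , u∈ , (λ eq → irrefl Y eq vu) , arrive)
    search (_◅_ {i = z} {j = z′} (zz′ , kept) es) with search es
    ... | inj₂ found = inj₂ found
    ... | inj₁ ear@(v′ , v′∈ , v≢v′ , path) with v ≟ z
    ...   | no v≢z with z ∈? S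
    ...     | yes z∈ = inj₁ (z , z∈ , v≢z , arrive)
    ...     | no z∉ = inj₁ (v′ , v′∈ , v≢v′ , step z∉ zz′ path)
    search (_◅_ {j = z′} (zz′ , kept) es) | inj₁ ear | yes refl with z′ ∈? S
    ...     | yes z′∈ = contradiction (inj₁ (refl , only z′∈ zz′)) kept
    ...     | no z′∉ = inj₂ (z′ , z′∉ , zz′ , ear)
  ... | inj₂ found = found
  ... | inj₁ (_ , _ , v≢v′ , arrive) = contradiction refl v≢v′
  ... | inj₁ (_ , _ , _ , step v∉ _ _) = contradiction v∈ v∉

  -- Some edge leaves `S` at a vertex `v`. If `v` has only one neighbour `u` in `S`, both ends of
  -- the edge from `v` to `u` have degree other than one, so a walk from `v` to `u` avoids that edge
  -- and yields an ear. The vertex absorbed is then the first one of the ear.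
  absorb-next : ∀ S → Grown S → (∀ w → w ∈ S) ⊎ ∃[ w ] (w ∉ S × Grown (w ∷ S))
  absorb-next S g with any? (λ w → ¬? (w ∈? S))
  ... | no none = inj₁ λ w → decidable-stable (w ∈? S) λ w∉ → none (w , w∉)
  ... | yes (x , x∉)
    with v , w , v∈ , vw , w∉ ← crossing-edge Y (_∈? S) (four⊆ g (here refl)) x∉ (walk Y conn c x)
    with u , u∈ , vu , choice ← anchored g v∈ = inj₂ (next choice)
    where
    load-two : ∀ {u′} → u′ ∈ S → u ≢ u′ → Adj Y v u′ → ∃[ w ] (w ∉ S × Grown (w ∷ S))
    load-two u′∈ u≢u′ vu′ = w , w∉ , absorb-neighbour g u∈ vu v∈ w∉ vw
      (load-from-two (exchangeable g) v∈ w∉ vw u∈ u′∈ u≢u′ vu vu′)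

    load-ear : ∃[ w ] (w ∉ S × Adj Y v w × ∃[ v′ ] (v′ ∈ S × v ≢ v′ × Ear S v′ w)) →
      ∃[ w ] (w ∉ S × Grown (w ∷ S))
    load-ear (w , w∉ , vw , v′ , v′∈ , v≢v′ , ear)
      -- Besides `v` and `v′`, the list `four` still has a place for `B` and one for the token to be
      -- loaded.
      with p , p∈ , p∉ ← escape {ys = v ∷ v′ ∷ []} unique-four (s≤s (s≤s (s≤s z≤n)))
      with q , q∈ , q∉ ← escape {ys = v ∷ v′ ∷ p ∷ []} unique-four (s≤s (s≤s (s≤s (s≤s z≤n)))) =
      w , w∉ , absorb-neighbour g u∈ vu v∈ w∉ vw
        (Conveyor.load-along-ear (exchangeable g) v∈ v′∈ (four⊆ g p∈) (four⊆ g q∈) v≢v′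
          (λ { refl → p∉ (there (here refl)) }) (λ { refl → q∉ (there (here refl)) })
          (λ { refl → p∉ (here refl) }) (λ { refl → q∉ (here refl) })
          (λ { refl → q∉ (there (there (here refl))) }) w∉ vw ear)

    next : degree Y u ≢ 1 ⊎ ∃[ u′ ] (u′ ∈ S × u ≢ u′ × Adj Y v u′) →
      ∃[ w ] (w ∉ S × Grown (w ∷ S))
    next (inj₂ (u′ , u′∈ , u≢u′ , vu′)) = load-two u′∈ u≢u′ vu′
    next (inj₁ deg) with any? (λ u′ → u′ ∈? S ×-dec ¬? (u ≟ u′) ×-dec adj? Y v u′)
    ... | yes (u′ , u′∈ , u≢u′ , vu′) = load-two u′∈ u≢u′ vu′
    ... | no none with reachable? (deleteEdge Y v u) v u
    ...   | yes es = load-ear (find-ear u∈ v∈ vu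
              (λ {y} y∈ vy → sym (decidable-stable (u ≟ y) λ u≢y → none (y , y∈ , u≢y , vy))) es)
    ...   | no cut = contradiction
              ((vu , λ conn′ → cut (walk (deleteEdge Y v u) conn′ v u))
              , degree≢1 Y vu vw (λ { refl → w∉ u∈ }) , deg)
              (cutless v u)

  all-≈ : ∀ σ τ → σ ≈ τ
  all-≈ σ τ with S , g , full ← grow absorb-next four unique-four grown-four =
    exchangeable g (full _ , full _) (full _ , full _) (agreeing λ l → inj₂ (full _ , full _))

  -- In each slide the blank at `r` leads. The labels at `r`, `a`, `b`, `c` pass from A B x y
  -- through B x A y and A x y B to B A y x.
  star-twist : ∀ (σ : State) {x y} → blank x ≡ false → blank y ≡ false → x ≢ y →
    σ ⟨$⟩ʳ A ≡ r → σ ⟨$⟩ʳ B ≡ a → σ ⟨$⟩ʳ x ≡ b → σ ⟨$⟩ʳ y ≡ c → σ ~[ true ] σ [ x ⇄ y ]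
  star-twist σ {x} {y} tx ty x≢y σA σB σx σy =
    twisted (~-trans S₁.reached (~-trans S₂.reached (~-trans S₃.reached (≐⇒~ (pointwise same)))))
    where
    ≢A : ∀ {z} → blank z ≡ false → z ≢ A
    ≢A = token≢blank refl

    ≢B : ∀ {z} → blank z ≡ false → z ≢ B
    ≢B = token≢blank refl

    adj : ∀ {p q p′ q′} → p ≡ p′ → q ≡ q′ → Adj Y p′ q′ → Adj Y p q
    adj refl refl e = e

    slide₁ : Slide σ A B x
    slide₁ = slide σ refl refl (λ ()) tx (adj σA σB ra) (adj σA σx rb)

    module S₁ = Slide slide₁

    y₁ : S₁.result ⟨$⟩ʳ y ≡ c
    y₁ = trans (S₁.at-other (≢A ty) (≢B ty) (≢-sym x≢y)) σy

    slide₂ : Slide S₁.result B A y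
    slide₂ = slide S₁.result refl refl (λ ()) ty
      (adj (trans S₁.at-β σA) (trans S₁.at-α σx) rb) (adj (trans S₁.at-β σA) y₁ rc)

    module S₂ = Slide slide₂

    A₂ : S₂.result ⟨$⟩ʳ A ≡ r
    A₂ = trans S₂.at-β (trans S₁.at-β σA)

    B₂ : S₂.result ⟨$⟩ʳ B ≡ c
    B₂ = trans S₂.at-α y₁

    x₂ : S₂.result ⟨$⟩ʳ x ≡ a
    x₂ = trans (S₂.at-other (≢B tx) (≢A tx) x≢y) (trans S₁.at-m σB)

    slide₃ : Slide S₂.result A B x
    slide₃ = slide S₂.result refl refl (λ ()) tx (adj A₂ B₂ rc) (adj A₂ x₂ ra)

    module S₃ = Slide slide₃

    y₃ : S₃.result ⟨$⟩ʳ y ≡ b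
    y₃ = trans (S₃.at-other (≢A ty) (≢B ty) (≢-sym x≢y)) (trans S₂.at-m (trans S₁.at-α σx))

    σ′ = σ [ x ⇄ y ]

    same : ∀ l → S₃.result ⟨$⟩ʳ l ≡ σ′ [ A ⇄ B ] ⟨$⟩ʳ l
    same A = trans S₃.at-α (trans x₂ (sym
      (trans (⇄-first σ′ A B) (trans (⇄-other σ (≢-sym (≢B tx)) (≢-sym (≢B ty))) σB))))
    same B = trans S₃.at-β (trans A₂ (sym
      (trans (⇄-second σ′ A B) (trans (⇄-other σ (≢-sym (≢A tx)) (≢-sym (≢A ty))) σA))))
    same l@(suc (suc _)) = trans (same-token (l ≟ x) (l ≟ y)) (sym (⇄-other σ′ (λ ()) (λ ())))
      where
      same-token : Dec (l ≡ x) → Dec (l ≡ y) → S₃.result ⟨$⟩ʳ l ≡ σ′ ⟨$⟩ʳ l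
      same-token (yes refl) _ = trans S₃.at-m (trans B₂ (sym (trans (⇄-first σ x y) σy)))
      same-token (no _) (yes refl) = trans y₃ (sym (trans (⇄-second σ x y) σx))
      same-token (no l≢x) (no l≢y) = trans (S₃.at-other (λ ()) (λ ()) l≢x)
        (trans (S₂.at-other (λ ()) (λ ()) l≢y)
          (trans (S₁.at-other (λ ()) (λ ()) l≢x) (sym (⇄-other σ l≢x l≢y))))

  -- A conjugate of `star-twist`: the way to a state with `x` and `y` at `b` and `c` and the way
  -- back have the same index, which cancels.
  token-twist : ∀ (σ : State) {x y} → blank x ≡ false → blank y ≡ false → x ≢ y →
    σ ~[ true ] σ [ x ⇄ y ]
  token-twist σ {x} {y} tx ty x≢y
    with ρ , ρA , ρB , ρx , _ ← place₃ {allFin (2 + k)} σ {A} {B} {x} (λ ())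
           (≢-sym (token≢blank refl tx)) (≢-sym (token≢blank refl tx)) ra≢ rb≢ a≢b (∈-allFin _) (∈-allFin _) (∈-allFin _)
           (∈-allFin _) (∈-allFin _) (∈-allFin _) = via (all-≈ σ (place ρ y c))
    where
    ρ′ = place ρ y c

    other : ∀ {z p} → z ≢ y → ρ ⟨$⟩ʳ z ≡ p → p ≢ c → ρ′ ⟨$⟩ʳ z ≡ p
    other z≢y refl p≢c = place-other ρ z≢y p≢c

    twist-ρ′ : ρ′ ~[ true ] ρ′ [ x ⇄ y ]
    twist-ρ′ = star-twist ρ′ tx ty x≢y
      (other (≢-sym (token≢blank refl ty)) ρA rc≢) (other (≢-sym (token≢blank refl ty)) ρB a≢c)
      (other x≢y ρx b≢c) (place-at ρ y c)

    via : σ ≈ ρ′ → σ ~[ true ] σ [ x ⇄ y ]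
    via (d , σ~ρ′) = subst (λ d → σ ~[ d ] σ [ x ⇄ y ]) (cancel d)
      (~[]-trans σ~ρ′ (~[]-trans twist-ρ′ (~[]-sym (~[]-relabel tx ty σ~ρ′))))
      where
      cancel : ∀ d → d xor (true xor d) ≡ true
      cancel false = refl
      cancel true = refl

  -- Moving A formally from a to the vertex of a token x gives a state related to
  -- ν either directly or after an exchange of A and B: this is the colour of
  -- ν x, while a is true and r is false.  Two adjacent vertices of the same
  -- colour yield an exchange of A and B.

  module Colouring (ν : State) (νA : ν ⟨$⟩ʳ A ≡ a) (νB : ν ⟨$⟩ʳ B ≡ r) where

    colour : Label → Bool
    colour A = true
    colour B = false
    colour x@(suc (suc _)) = proj₁ (all-≈ (ν [ A ⇄ x ]) ν)

    coloured : ∀ x → ν [ A ⇄ suc (suc x) ] ~[ colour (suc (suc x)) ] ν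
    coloured x = proj₂ (all-≈ (ν [ A ⇄ suc (suc x) ]) ν)

    other-arm : ∀ p → ∃[ q ] (Adj Y r q × a ≢ q × p ≢ q)
    other-arm p with p ≟ b
    ... | yes refl = c , rc , a≢c , b≢c
    ... | no p≢b = b , rb , a≢b , p≢b

    -- `B` blocks the way of `A` through `r`. So `B` backs into a spare arm `q` with `A` following,
    -- and then `A` leaves for the place of `y` while `B` returns to `r`. The tokens `y` and `z` are
    -- now interchanged, which `token-twist` repairs.
    through-r : ∀ {y} → blank y ≡ false → Adj Y r (ν ⟨$⟩ʳ y) → ν ~[ true ] ν [ A ⇄ y ]
    through-r {y} ty ry with q , rq , a≢q , y≢q ← other-arm (ν ⟨$⟩ʳ y) =
      ~[]-trans
        (twisted {b = false} (~-trans S₁.reached (~-trans S₂.reached (≐⇒~ (pointwise same)))))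
        (~[]-sym (token-twist (ν [ A ⇄ y ]) ty tz y≢z))
      where
      z : Label
      z = ν ⟨$⟩ˡ q

      νz : ν ⟨$⟩ʳ z ≡ q
      νz = inverseʳ ν

      tz : blank z ≡ false
      tz = occupant-token ν (λ eq → a≢q (trans (sym νA) eq))
        (λ eq → irrefl Y (trans (sym νB) eq) rq)

      y≢z : y ≢ z
      y≢z = occupant-≢ ν y≢q

      slide₁ : Slide ν B A z
      slide₁ = slide ν refl refl (λ ()) tz
        (subst₂ (Adj Y) (sym νB) (sym νA) ra) (subst₂ (Adj Y) (sym νB) (sym νz) rq)

      module S₁ = Slide slide₁

      y₁ : S₁.result ⟨$⟩ʳ y ≡ ν ⟨$⟩ʳ y
      y₁ = S₁.at-other (token≢blank refl ty) (token≢blank refl ty) y≢z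

      slide₂ : Slide S₁.result A B y
      slide₂ = slide S₁.result refl refl (λ ()) ty
        (subst₂ (Adj Y) (sym (trans S₁.at-β νB)) (sym (trans S₁.at-α νz)) rq)
        (subst₂ (Adj Y) (sym (trans S₁.at-β νB)) (sym y₁) ry)

      module S₂ = Slide slide₂

      same : ∀ l → S₂.result ⟨$⟩ʳ l ≡ ν [ A ⇄ y ] [ y ⇄ z ] ⟨$⟩ʳ l
      same A = trans S₂.at-α (trans y₁ (sym (trans
        (⇄-other (ν [ A ⇄ y ]) (≢-sym (token≢blank refl ty)) (≢-sym (token≢blank refl tz)))
        (⇄-first ν A y))))
      same B = trans S₂.at-β (trans S₁.at-β (sym (trans
        (⇄-other (ν [ A ⇄ y ]) (≢-sym (token≢blank refl ty)) (≢-sym (token≢blank refl tz)))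
        (⇄-other ν (λ ()) (≢-sym (token≢blank refl ty))))))
      same l@(suc (suc _)) = same-token (l ≟ y) (l ≟ z)
        where
        ν′ = ν [ A ⇄ y ]

        same-token : Dec (l ≡ y) → Dec (l ≡ z) → S₂.result ⟨$⟩ʳ l ≡ ν′ [ y ⇄ z ] ⟨$⟩ʳ l
        same-token (yes refl) _ = trans S₂.at-m (trans S₁.at-α (sym
          (trans (⇄-first ν′ y z) (⇄-other ν (token≢blank refl tz) (≢-sym y≢z)))))
        same-token (no l≢y) (yes l≡z) = trans (S₂.at-other (λ ()) (λ ()) l≢y)
          (trans (cong (S₁.result ⟨$⟩ʳ_) l≡z) (trans S₁.at-m (sym (trans
            (cong (ν′ [ y ⇄ z ] ⟨$⟩ʳ_) l≡z) (trans (⇄-second ν′ y z) (⇄-second ν A y))))))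
        same-token (no l≢y) (no l≢z) = trans (S₂.at-other (λ ()) (λ ()) l≢y)
          (trans (S₁.at-other (λ ()) (λ ()) l≢z)
            (sym (trans (⇄-other ν′ l≢y l≢z) (⇄-other ν (λ ()) l≢y))))

    -- Moving `A` along the edge gives the right-hand state with `x` and `y` interchanged;
    -- `token-twist` repairs this at the price of one exchange of the blanks.
    direct : ∀ {x y} → blank x ≡ false → blank y ≡ false → Adj Y (ν ⟨$⟩ʳ x) (ν ⟨$⟩ʳ y) →
      ν [ A ⇄ x ] ~[ true ] ν [ A ⇄ y ]
    direct {x} {y} tx ty xy =
      ~[]-trans (twisted {b = false} (~-trans (move (ν [ A ⇄ x ]) refl ty
          (subst₂ (Adj Y) (sym (⇄-first ν A x)) (sym y₁) xy)) (≐⇒~ (pointwise same))))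
        (~[]-sym (token-twist (ν [ A ⇄ y ]) tx ty x≢y))
      where
      x≢y : x ≢ y
      x≢y refl = irrefl Y refl xy

      x≢A = token≢blank refl tx
      y≢A = token≢blank refl ty

      y₁ : ν [ A ⇄ x ] ⟨$⟩ʳ y ≡ ν ⟨$⟩ʳ y
      y₁ = ⇄-other ν y≢A (≢-sym x≢y)

      same : ∀ l → ν [ A ⇄ x ] [ A ⇄ y ] ⟨$⟩ʳ l ≡ ν [ A ⇄ y ] [ x ⇄ y ] ⟨$⟩ʳ l
      same A = trans (⇄-first (ν [ A ⇄ x ]) A y) (trans y₁ (sym
        (trans (⇄-other (ν [ A ⇄ y ]) (≢-sym x≢A) (≢-sym y≢A)) (⇄-first ν A y))))
      same l@(suc _) = same-token (l ≟ x) (l ≟ y)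
        where
        νx = ν [ A ⇄ x ]
        νy = ν [ A ⇄ y ]

        same-token : Dec (l ≡ x) → Dec (l ≡ y) → νx [ A ⇄ y ] ⟨$⟩ʳ l ≡ νy [ x ⇄ y ] ⟨$⟩ʳ l
        same-token (yes refl) _ = trans (⇄-other νx x≢A x≢y) (trans (⇄-second ν A x)
          (sym (trans (⇄-first νy x y) (⇄-second ν A y))))
        same-token (no l≢x) (yes refl) = trans (⇄-second νx A y) (trans (⇄-first ν A x)
          (sym (trans (⇄-second νy x y) (⇄-other ν x≢A x≢y))))
        same-token (no l≢x) (no l≢y) = trans (⇄-other νx (λ ()) l≢y) (trans (⇄-other ν (λ ()) l≢x)
          (sym (trans (⇄-other νy l≢x l≢y) (⇄-other ν (λ ()) l≢y))))

    -- A closed chain of relations runs from `ν` across the edge and back to `ν`; equality of the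
    -- two colours makes its index `true`.
    clash : ∀ x y → colour x ≡ colour y → Adj Y (ν ⟨$⟩ʳ x) (ν ⟨$⟩ʳ y) → ν ~[ true ] ν
    clash A A _ e = contradiction e (irrefl Y refl)
    clash B B _ e = contradiction e (irrefl Y refl)
    clash A (suc (suc y)) eq e = subst (ν ~[_] ν) (sym eq)
      (~[]-trans (twisted {b = false} (move ν refl refl e)) (coloured y))
    clash B (suc (suc y)) eq e = subst (λ d → ν ~[ not d ] ν) (sym eq)
      (~[]-trans (through-r refl (subst (λ v → Adj Y v _) νB e)) (coloured y))
    clash x@(suc (suc _)) A eq e = clash A x (sym eq) (symm Y e)
    clash x@(suc (suc _)) B eq e = clash B x (sym eq) (symm Y e)
    clash (suc (suc x)) (suc (suc y)) eq e = subst (ν ~[_] ν) (cancel eq)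
      (~[]-trans (~[]-sym (coloured x)) (~[]-trans (direct refl refl e) (coloured y)))
      where
      cancel : ∀ {d d′} → d ≡ d′ → d xor (true xor d′) ≡ true
      cancel {false} refl = refl
      cancel {true} refl = refl

    part : Vertex → Bool
    part v = colour (ν ⟨$⟩ˡ v)

    twisted-loop : ν ~[ true ] ν
    twisted-loop with any? (λ v → any? λ w → adj? Y v w ×-dec (part v Bool.≟ part w))
    ... | no none = contradiction (part , λ v w vw eq → none (v , w , vw , eq)) nonbipartite
    ... | yes (v , w , vw , eq) =
      clash _ _ eq (subst₂ (Adj Y) (sym (inverseʳ ν)) (sym (inverseʳ ν)) vw)

  connected : Connected G
  connected σ τ = reach⇒ (~-trans (to-ν σ) (~-sym (to-ν τ)))
    where
    ν₁ ν : State
    ν₁ = place σ A a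
    ν = place ν₁ B r

    νA : ν ⟨$⟩ʳ A ≡ a
    νA = trans (place-other ν₁ {x = B} (λ ()) λ eq → ra≢ (trans (sym eq) (place-at σ A a)))
      (place-at σ A a)

    loop : ν ~[ true ] ν
    loop = Colouring.twisted-loop ν νA (place-at ν₁ B r)

    drop-twist : ∀ {υ} → υ ≈ ν → υ ~ ν
    drop-twist (false , υ~ν) = untwist υ~ν
    drop-twist (true , υ~ν) = untwist (~[]-trans υ~ν loop)

    to-ν : ∀ υ → υ ~ ν
    to-ν υ = drop-twist (all-≈ υ ν)

    reach⇒ : ∀ {σ τ} → σ ~ τ → ∃[ ω ] (Star (Adj G) σ ω × (∀ x → ω ⟨$⟩ʳ x ≡ τ ⟨$⟩ʳ x))
    reach⇒ (reach es ω≐τ) = _ , es , at ω≐τ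

-- Invariants

open CommutativeMonoidSum (CommutativeRing.+-commutativeMonoid Bool.xor-∧-commutativeRing)
  using (sum; sum-cong-≗; sum-permute)

-- Inversions modulo two

infix 7 _<′_

_<′_ : ℕ → ℕ → Bool
i <′ j = does (i <? j)

<′-flip : ∀ {i j} → i ≢ j → j <′ i ≡ not (i <′ j)
<′-flip {i} {j} i≢j with <-cmp i j
... | tri< i<j _ j≮i rewrite dec-true (i <? j) i<j = dec-false (j <? i) j≮i
... | tri≈ _ i≡j _ = contradiction i≡j i≢j
... | tri> i≮j _ j<i rewrite dec-false (i <? j) i≮j = dec-true (j <? i) j<i

-- As `sum` adds with `_xor_`, this is the sign when the values come from a permutation. General
-- functions are allowed since the tail of a permutation is not one.
inversion-parity : (Fin n → ℕ) → Bool
inversion-parity {zero} f = false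
inversion-parity {suc n} f = sum (λ j → f (suc j) <′ f zero) xor inversion-parity (f ∘ suc)

inversion-parity-cong : {f g : Fin n → ℕ} → f ≗ g → inversion-parity f ≡ inversion-parity g
inversion-parity-cong {zero} f≗g = refl
inversion-parity-cong {suc n} f≗g = cong₂ _xor_
  (sum-cong-≗ λ j → cong₂ _<′_ (f≗g (suc j)) (f≗g zero))
  (inversion-parity-cong (f≗g ∘ suc))

transpose-suc : (a b j : Fin n) → PC.transpose (suc a) (suc b) (suc j) ≡ suc (PC.transpose a b j)
transpose-suc a b j with j ≟ a
... | yes _ = refl
... | no _ with j ≟ b
...   | yes _ = refl
...   | no _ = refl

transpose-sym : (a b j : Fin n) → PC.transpose a b j ≡ PC.transpose b a j
transpose-sym a b j = decide (j ≟ a) (j ≟ b)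
  where
  decide : Dec (j ≡ a) → Dec (j ≡ b) → PC.transpose a b j ≡ PC.transpose b a j
  decide (yes refl) _ = trans (transpose-first a b) (sym (transpose-second b a))
  decide (no _) (yes refl) = trans (transpose-second a b) (sym (transpose-first b a))
  decide (no j≢a) (no j≢b) = trans (transpose-other j≢a j≢b) (sym (transpose-other j≢b j≢a))

DistinctValues : (Fin n → ℕ) → Set
DistinctValues f = ∀ {i j} → i ≢ j → f i ≢ f j

-- Only the comparison of the first two entries is reversed; their comparisons with later entries
-- are merely regrouped.
flip-adjacent : (f : Fin (2 + n) → ℕ) → DistinctValues f →
  inversion-parity (f ∘ PC.transpose zero (suc zero)) ≡ not (inversion-parity f)
flip-adjacent f distinct
  rewrite <′-flip {f (suc zero)} {f zero} (distinct λ ()) =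
  rearrange (f (suc zero) <′ f zero) (sum (λ j → f (suc (suc j)) <′ f zero))
    (sum (λ j → f (suc (suc j)) <′ f (suc zero))) (inversion-parity λ j → f (suc (suc j)))
  where
  rearrange : ∀ p q r s → (not p xor r) xor (q xor s) ≡ not ((p xor q) xor (r xor s))
  rearrange false false false s = refl
  rearrange false false true  s = sym (Bool.not-involutive _)
  rearrange false true  false s = refl
  rearrange false true  true  s = sym (Bool.not-involutive _)
  rearrange true  false false s = sym (Bool.not-involutive _)
  rearrange true  false true  s = sym (Bool.not-involutive _)
  rearrange true  true  false s = refl
  rearrange true  true  true  s = refl

xor-notʳ : ∀ p q → p xor not q ≡ not (p xor q)
xor-notʳ false q = refl
xor-notʳ true q = refl

-- The number of entries below the first one does not depend on the order of the tail.
flip-suc : (f : Fin (suc n) → ℕ) (a b : Fin n) →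
  inversion-parity (f ∘ suc ∘ PC.transpose a b) ≡ not (inversion-parity (f ∘ suc)) →
  inversion-parity (f ∘ PC.transpose (suc a) (suc b)) ≡ not (inversion-parity f)
flip-suc f a b flip-tail = trans
  (cong₂ _xor_
    (trans (sum-cong-≗ λ j → cong (λ i → f i <′ f zero) (transpose-suc a b j))
      (sym (sum-permute (λ j → f (suc j) <′ f zero) (transpose a b))))
    (trans (inversion-parity-cong (cong f ∘ transpose-suc a b)) flip-tail))
  (xor-notʳ (sum λ j → f (suc j) <′ f zero) _)

-- (0 b) = (0 1)(1 b)(0 1)

flip-zero : (f : Fin (suc n) → ℕ) → DistinctValues f → ∀ b →
  inversion-parity (f ∘ PC.transpose zero (suc b)) ≡ not (inversion-parity f)
flip-zero f distinct zero = flip-adjacent f distinct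
flip-zero f distinct (suc b) = begin
  inversion-parity (f ∘ PC.transpose zero (suc (suc b)))  ≡⟨ inversion-parity-cong (cong f ∘ conjugate) ⟩
  inversion-parity (h ∘ t₀₁)                              ≡⟨ flip-adjacent h h-distinct ⟩
  not (inversion-parity h)                                ≡⟨ cong not flip-h ⟩
  not (not (inversion-parity g))                          ≡⟨ Bool.not-involutive _ ⟩
  inversion-parity g                                      ≡⟨ flip-adjacent f distinct ⟩
  not (inversion-parity f)                                ∎
  where
  open ≡-Reasoning
  t₀₁ = PC.transpose zero (suc zero)
  t₁ = PC.transpose (suc zero) (suc (suc b))
  g = f ∘ t₀₁
  h = g ∘ t₁

  transpose-distinct : ∀ {m} {a b i j : Fin m} → i ≢ j → PC.transpose a b i ≢ PC.transpose a b j
  transpose-distinct {a = a} {b} i≢j eq = i≢j (trans (sym (transpose-involutive a b _))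
    (trans (cong (PC.transpose a b) eq) (transpose-involutive a b _)))

  g-distinct : DistinctValues g
  g-distinct i≢j = distinct (transpose-distinct {a = zero} {suc zero} i≢j)

  tail-distinct : DistinctValues (g ∘ suc)
  tail-distinct {i} {j} i≢j = g-distinct {suc i} {suc j} λ { refl → i≢j refl }

  h-distinct : DistinctValues h
  h-distinct i≢j = g-distinct (transpose-distinct {a = suc zero} {suc (suc b)} i≢j)

  flip-h : inversion-parity h ≡ not (inversion-parity g)
  flip-h = flip-suc g zero (suc b) (flip-zero (g ∘ suc) tail-distinct b)

  conjugate : ∀ i → PC.transpose zero (suc (suc b)) i ≡ t₀₁ (t₁ (t₀₁ i))
  conjugate zero = refl
  conjugate (suc zero) = refl
  conjugate (suc (suc i)) with i ≟ b
  ... | yes _ = refl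
  ... | no _ = refl

inversion-parity-flip : (f : Fin n → ℕ) → DistinctValues f → ∀ {a b} → a ≢ b →
  inversion-parity (f ∘ PC.transpose a b) ≡ not (inversion-parity f)
inversion-parity-flip f distinct {zero} {zero} a≢b = contradiction refl a≢b
inversion-parity-flip f distinct {zero} {suc b} a≢b = flip-zero f distinct b
inversion-parity-flip f distinct {suc a} {zero} a≢b =
  trans (inversion-parity-cong (cong f ∘ transpose-sym (suc a) zero)) (flip-zero f distinct a)
inversion-parity-flip f distinct {suc a} {suc b} a≢b =
  flip-suc f a b (inversion-parity-flip (f ∘ suc)
    (λ i≢j → distinct λ { refl → i≢j refl }) λ { refl → a≢b refl })

-- Moves, connectedness and the parity invariant

module Necessity {k : ℕ} (Y : FinGraph (4 + k)) where

  open Reach Y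

  record IsMove (σ τ : State) (x y : Label) : Set where
    field
      blank-x  : blank x ≡ true
      token-y  : blank y ≡ false
      adjacent : Adj Y (σ ⟨$⟩ʳ x) (σ ⟨$⟩ʳ y)
      at-x     : τ ⟨$⟩ʳ x ≡ σ ⟨$⟩ʳ y
      at-y     : τ ⟨$⟩ʳ y ≡ σ ⟨$⟩ʳ x
      at-other : ∀ {z} → z ≢ x → z ≢ y → τ ⟨$⟩ʳ z ≡ σ ⟨$⟩ʳ z

    x≢y : x ≢ y
    x≢y = ≢-sym (token≢blank blank-x token-y)

    ≐-⇄ : τ ≐ σ [ x ⇄ y ]
    ≐-⇄ = pointwise λ l → compare (l ≟ x) (l ≟ y)
      where
      compare : ∀ {l} → Dec (l ≡ x) → Dec (l ≡ y) → τ ⟨$⟩ʳ l ≡ σ [ x ⇄ y ] ⟨$⟩ʳ l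
      compare (yes refl) _ = trans at-x (sym (⇄-first σ x y))
      compare (no _) (yes refl) = trans at-y (sym (⇄-second σ x y))
      compare (no l≢x) (no l≢y) = trans (at-other l≢x l≢y) (sym (⇄-other σ l≢x l≢y))

  is-move : ∀ {σ τ} → Adj G σ τ → ∃[ x ] ∃[ y ] IsMove σ τ x y
  is-move (x , y , xy , σxσy , p , q , r) with adj-blank xy
  ... | inj₁ (bx , ty) = x , y , record
    { blank-x = bx ; token-y = ty ; adjacent = σxσy ; at-x = sym q ; at-y = sym p
    ; at-other = λ z≢x z≢y → sym (r _ z≢x z≢y) }
  ... | inj₂ (by , tx) = y , x , record
    { blank-x = by ; token-y = tx ; adjacent = symm Y σxσy ; at-x = sym p ; at-y = sym q
    ; at-other = λ z≢y z≢x → sym (r _ z≢x z≢y) }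

  id : State
  id = Permutation.id

  connected : Connected G → Connected Y
  connected conn u v with conn id (id [ u ⇄ v ])
  ... | ω , es , ω≐ = ω ⟨$⟩ʳ u , follow es , trans (ω≐ u) (⇄-first id u v)
    where
    step : ∀ {σ τ} → Adj G σ τ → Star (Adj Y) (σ ⟨$⟩ʳ u) (τ ⟨$⟩ʳ u)
    step {σ} {τ} e with is-move {σ} {τ} e
    ... | x , y , m = along (u ≟ x) (u ≟ y)
      where
      open IsMove m
      along : Dec (u ≡ x) → Dec (u ≡ y) → Star (Adj Y) (σ ⟨$⟩ʳ u) (τ ⟨$⟩ʳ u)
      along (yes refl) _ = subst (Adj Y _) (sym at-x) adjacent ◅ ε
      along (no _) (yes refl) = subst (Adj Y _) (sym at-y) (symm Y adjacent) ◅ ε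
      along (no u≢x) (no u≢y) = subst (Star (Adj Y) _) (sym (at-other u≢x u≢y)) ε

    follow : ∀ {σ τ} → Star (Adj G) σ τ → Star (Adj Y) (σ ⟨$⟩ʳ u) (τ ⟨$⟩ʳ u)
    follow ε = ε
    follow (_◅_ {i = σ} {j = τ} e es) = step {σ} {τ} e ◅◅ follow es

  constant : (f : State → Bool) → (∀ {σ τ} → σ ≐ τ → f σ ≡ f τ) →
    (∀ {σ τ x y} → IsMove σ τ x y → f σ ≡ f τ) → Connected G → ∀ σ τ → f σ ≡ f τ
  constant f resp-≐ preserved conn σ τ with conn σ τ
  ... | ω , es , ω≐τ = trans (follow es) (resp-≐ (pointwise ω≐τ))
    where
    follow : ∀ {σ τ} → Star (Adj G) σ τ → f σ ≡ f τ
    follow ε = refl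
    follow (_◅_ {i = σ} {j = τ} e es) with is-move {σ} {τ} e
    ... | _ , _ , m = trans (preserved m) (follow es)

  token₀ token₁ : Label
  token₀ = suc (suc zero)
  token₁ = suc (suc (suc zero))

  module _ (part : Vertex → Bool) (proper : ∀ u v → Adj Y u v → part u ≢ part v) where

    sign : State → Bool
    sign σ = inversion-parity (toℕ ∘ (σ ⟨$⟩ʳ_))

    colour-sign : State → Bool
    colour-sign σ = (part (σ ⟨$⟩ʳ A) xor part (σ ⟨$⟩ʳ B)) xor sign σ

    sign-⇄ : ∀ (σ : State) {x y} → x ≢ y → sign (σ [ x ⇄ y ]) ≡ not (sign σ)
    sign-⇄ σ {x} {y} x≢y = trans (inversion-parity-cong (cong toℕ ∘ ⇄-transpose σ x y))
      (inversion-parity-flip (toℕ ∘ (σ ⟨$⟩ʳ_)) (λ i≢j → distinct σ i≢j ∘ toℕ-injective) x≢y)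

    sign-cong : ∀ {σ τ} → σ ≐ τ → sign σ ≡ sign τ
    sign-cong σ≐τ = inversion-parity-cong (cong toℕ ∘ at σ≐τ)

    colour-sign-cong : ∀ {σ τ} → σ ≐ τ → colour-sign σ ≡ colour-sign τ
    colour-sign-cong σ≐τ = cong₂ _xor_
      (cong₂ _xor_ (cong part (at σ≐τ A)) (cong part (at σ≐τ B))) (sign-cong σ≐τ)

    flips : ∀ {u v} → Adj Y u v → part v ≡ not (part u)
    flips uv = Bool.¬-not (proper _ _ (symm Y uv))

    -- A move is a transposition and takes exactly one blank to the other colour, so exactly two
    -- summands change.
    colour-sign-preserved : ∀ {σ τ x y} → IsMove σ τ x y → colour-sign σ ≡ colour-sign τ
    colour-sign-preserved {σ} {τ} {x} {y} m = trans (balance x refl blank-x)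
        (cong ((part (τ ⟨$⟩ʳ A) xor part (τ ⟨$⟩ʳ B)) xor_) (sym sign-flips))
      where
      open IsMove m

      sign-flips : sign τ ≡ not (sign σ)
      sign-flips = trans (sign-cong ≐-⇄) (sign-⇄ σ x≢y)

      flipped : part (τ ⟨$⟩ʳ x) ≡ not (part (σ ⟨$⟩ʳ x))
      flipped = trans (cong part at-x) (flips adjacent)

      first : ∀ p q s → (p xor q) xor s ≡ (not p xor q) xor not s
      first false false s = sym (Bool.not-involutive s)
      first false true  s = refl
      first true  false s = refl
      first true  true  s = sym (Bool.not-involutive s)

      second : ∀ p q s → (p xor q) xor s ≡ (p xor not q) xor not s
      second false false s = sym (Bool.not-involutive s)
      second false true  s = refl
      second true  false s = refl
      second true  true  s = sym (Bool.not-involutive s)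

      balance : ∀ z → z ≡ x → blank z ≡ true →
        colour-sign σ ≡ (part (τ ⟨$⟩ʳ A) xor part (τ ⟨$⟩ʳ B)) xor not (sign σ)
      balance A refl _ = trans (first (part (σ ⟨$⟩ʳ A)) _ (sign σ))
        (cong₂ (λ p q → (p xor q) xor not (sign σ)) (sym flipped)
          (cong part (sym (at-other (λ ()) (≢-sym (token≢blank refl token-y))))))
      balance B refl _ = trans (second (part (σ ⟨$⟩ʳ A)) _ (sign σ))
        (cong₂ (λ p q → (p xor q) xor not (sign σ))
          (cong part (sym (at-other (λ ()) (≢-sym (token≢blank refl token-y))))) (sym flipped))

    -- Exchanging two tokens changes the sign and leaves the blanks in place; two tokens exist
    -- because `Y` has at least four vertices.
    bipartite⇒disconnected : ¬ Connected G
    bipartite⇒disconnected conn = Bool.not-¬ refl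
      (trans (constant colour-sign colour-sign-cong colour-sign-preserved conn
                id (id [ token₀ ⇄ token₁ ]))
        (trans (cong₂ (λ u v → (part u xor part v) xor sign (id [ token₀ ⇄ token₁ ]))
            (⇄-other id (λ ()) (λ ())) (⇄-other id (λ ()) (λ ())))
          (trans (cong ((part A xor part B) xor_) (sign-⇄ id {token₀} {token₁} λ ()))
            (xor-notʳ (part A xor part B) (sign id)))))

-- The invariant of a cut edge

record Bipartition {n} (G : FinGraph n) (a b : Fin n) : Set where
  field
    inside   : Fin n → Bool
    inside-a : inside a ≡ true
    inside-b : inside b ≡ false
    kept     : ∀ {u v} → Adj G u v → ¬ SamePair a b u v → inside u ≡ inside v

samePair? : (a b u v : Fin n) → Dec (SamePair a b u v)
samePair? a b u v = (u ≟ a ×-dec v ≟ b) ⊎-dec (u ≟ b ×-dec v ≟ a)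

-- The side of `a` is what `a` still reaches without the edge. If it reached `b`, every walk could
-- be rerouted and the deletion would not disconnect the graph.
cut⇒bipartition : (G : FinGraph n) → Connected G → ∀ {a b} →
  ¬ Connected (deleteEdge G a b) → Bipartition G a b
cut⇒bipartition G conn {a} {b} disconnected = record
  { inside   = λ v → does (reachable? D a v)
  ; inside-a = dec-true (reachable? D a a) ε
  ; inside-b = dec-false (reachable? D a b) λ es →
      disconnected (walks⇒connected D λ u v → reroute es (walk G conn u v))
  ; kept     = λ {u} {v} uv ≢e → same (reachable? D a u) (uv , ≢e)
  }
  where
  D = deleteEdge G a b

  detour : Star (Adj D) a b → ∀ {u v} → Adj G u v → Dec (SamePair a b u v) → Star (Adj D) u v
  detour es uv (yes (inj₁ (refl , refl))) = es
  detour es uv (yes (inj₂ (refl , refl))) = Star.reverse (λ {x} {y} → symm D {x} {y}) es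
  detour es uv (no ≢e) = (uv , ≢e) ◅ ε

  reroute : Star (Adj D) a b → ∀ {u v} → Star (Adj G) u v → Star (Adj D) u v
  reroute es ε = ε
  reroute es (e ◅ rest) = detour es e (samePair? a b _ _) ◅◅ reroute es rest

  same : ∀ {u v} → Dec (Star (Adj D) a u) → Adj D u v →
    does (reachable? D a u) ≡ does (reachable? D a v)
  same (yes es) e =
    trans (dec-true (reachable? D a _) es) (sym (dec-true (reachable? D a _) (es ◅◅ e ◅ ε)))
  same (no ¬es) e = trans (dec-false (reachable? D a _) ¬es)
    (sym (dec-false (reachable? D a _) λ es → ¬es (es ◅◅ symm D e ◅ ε)))

-- Whether a token belongs to the side of a: the arguments tell whether the
-- two blanks and the token are on the side of a, and whether the token is at
-- b or at a.  With both blanks on one side, the token that has crossed the cut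
-- edge still counts for the side that it came from, as only it can be pushed
-- back.

side : Bool → Bool → Bool → Bool → Bool → Bool
side true  true  p at-b at-a = p ∨ at-b
side false false p at-b at-a = p ∧ not at-a
side true  false p at-b at-a = p
side false true  p at-b at-a = p

side-comm : ∀ v w p i j → side v w p i j ≡ side w v p i j
side-comm true  true  p i j = refl
side-comm true  false p i j = refl
side-comm false true  p i j = refl
side-comm false false p i j = refl

side-near : ∀ v w i j → side v w v i j ≡ v
side-near true  true  i j = refl
side-near true  false i j = refl
side-near false true  i j = refl
side-near false false i j = refl

side-away : ∀ v w p → side v w p false false ≡ p
side-away true  true  p = Bool.∨-identityʳ p
side-away true  false p = refl
side-away false true  p = refl
side-away false false p = Bool.∧-identityʳ p

side-at-b : ∀ w j → side true w false true j ≡ w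
side-at-b true  j = refl
side-at-b false j = refl

side-at-a : ∀ w i → side false w true i true ≡ w
side-at-a true  i = refl
side-at-a false i = refl

module CutEdgeNecessity {k : ℕ} (Y : FinGraph (4 + k)) where

  open Exchange Y
  open Necessity Y hiding (connected)

  module _ {a b : Vertex} (sides : Bipartition Y a b) (l : Label) (tl : blank l ≡ false) where

    open Bipartition sides

    side-of : Bool → Bool → Vertex → Bool
    side-of v w p = side v w (inside p) (does (p ≟ b)) (does (p ≟ a))

    belongs : State → Bool
    belongs σ = side-of (inside (σ ⟨$⟩ʳ A)) (inside (σ ⟨$⟩ʳ B)) (σ ⟨$⟩ʳ l)

    side-of-b : ∀ w → side-of true w b ≡ w
    side-of-b w rewrite inside-b | dec-true (b ≟ b) refl = side-at-b w (does (b ≟ a))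

    side-of-a : ∀ w → side-of false w a ≡ w
    side-of-a w rewrite inside-a | dec-true (a ≟ a) refl = side-at-a w (does (a ≟ b))

    side-of-other : ∀ v w {p} → p ≢ a → p ≢ b → side-of v w p ≡ inside p
    side-of-other v w {p} p≢a p≢b
      rewrite dec-false (p ≟ a) p≢a | dec-false (p ≟ b) p≢b = side-away v w (inside p)

    side-of-near : ∀ {v} w p → inside p ≡ v → side-of v w p ≡ v
    side-of-near w p refl = side-near (inside p) w (does (p ≟ b)) (does (p ≟ a))

    -- A blank goes from `p` to `q` and the token from `q` to `p`, while `w` is the side of the
    -- other blank. Across the cut edge, the token belongs to the side `w` before and after; along
    -- any other edge, it is on the same side as the moving blank.
    push : ∀ w {p q} → Adj Y p q → side-of (inside p) w q ≡ side-of (inside q) w p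
    push w {p} {q} pq with samePair? a b p q
    ... | yes (inj₁ (refl , refl)) =
      trans (cong (λ v → side-of v w b) inside-a) (trans (side-of-b w)
        (sym (trans (cong (λ v → side-of v w a) inside-b) (side-of-a w))))
    ... | yes (inj₂ (refl , refl)) =
      trans (cong (λ v → side-of v w a) inside-b) (trans (side-of-a w)
        (sym (trans (cong (λ v → side-of v w b) inside-a) (side-of-b w))))
    ... | no ≢e = trans (side-of-near w q (sym (kept pq ≢e)))
                    (trans (kept pq ≢e) (sym (side-of-near w p (kept pq ≢e))))

    -- If the blank crosses the cut edge, the token is at neither end and belongs where it stands;
    -- otherwise the blank stays on its side.
    pass : ∀ w {p q s} → Adj Y p q → s ≢ p → s ≢ q →
      side-of (inside p) w s ≡ side-of (inside q) w s
    pass w {p} {q} {s} pq s≢p s≢q with samePair? a b p q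
    ... | yes (inj₁ (refl , refl)) =
      trans (side-of-other (inside a) w s≢p s≢q) (sym (side-of-other (inside b) w s≢p s≢q))
    ... | yes (inj₂ (refl , refl)) =
      trans (side-of-other (inside b) w s≢q s≢p) (sym (side-of-other (inside a) w s≢q s≢p))
    ... | no ≢e = cong (λ v → side-of v w s) (kept pq ≢e)

    belongs-cong : ∀ {σ τ} → σ ≐ τ → belongs σ ≡ belongs τ
    belongs-cong {σ} {τ} σ≐τ
      rewrite at σ≐τ A | at σ≐τ B | at σ≐τ l = refl

    belongs-preserved : ∀ {σ τ x y} → IsMove σ τ x y → belongs σ ≡ belongs τ
    belongs-preserved {σ} {τ} {x} {y} m = balance x refl blank-x
      where
      open IsMove m

      shift : ∀ w →
        side-of (inside (σ ⟨$⟩ʳ x)) w (σ ⟨$⟩ʳ l) ≡ side-of (inside (τ ⟨$⟩ʳ x)) w (τ ⟨$⟩ʳ l)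
      shift w = trans (compare (l ≟ y)) (cong (λ p → side-of (inside p) w (τ ⟨$⟩ʳ l)) (sym at-x))
        where
        compare : Dec (l ≡ y) →
          side-of (inside (σ ⟨$⟩ʳ x)) w (σ ⟨$⟩ʳ l) ≡ side-of (inside (σ ⟨$⟩ʳ y)) w (τ ⟨$⟩ʳ l)
        compare (yes refl) =
          trans (push w adjacent) (cong (side-of (inside (σ ⟨$⟩ʳ y)) w) (sym at-y))
        compare (no l≢y) =
          trans (pass w adjacent (distinct σ l≢x) (distinct σ l≢y))
            (cong (side-of (inside (σ ⟨$⟩ʳ y)) w) (sym (at-other l≢x l≢y)))
          where
          l≢x = token≢blank blank-x tl

      comm : ∀ v w p → side-of v w p ≡ side-of w v p
      comm v w p = side-comm v w (inside p) (does (p ≟ b)) (does (p ≟ a))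

      unmoved : ∀ {z} → blank z ≡ true → z ≢ x → inside (σ ⟨$⟩ʳ z) ≡ inside (τ ⟨$⟩ʳ z)
      unmoved bz z≢x = cong inside (sym (at-other z≢x (≢-sym (token≢blank bz token-y))))

      balance : ∀ z → z ≡ x → blank z ≡ true → belongs σ ≡ belongs τ
      balance A refl _ = trans (shift (inside (σ ⟨$⟩ʳ B)))
        (cong (λ w → side-of (inside (τ ⟨$⟩ʳ A)) w (τ ⟨$⟩ʳ l)) (unmoved refl λ ()))
      balance B refl _ = trans (comm (inside (σ ⟨$⟩ʳ A)) (inside (σ ⟨$⟩ʳ B)) (σ ⟨$⟩ʳ l))
        (trans (shift (inside (σ ⟨$⟩ʳ A)))
        (trans (cong (λ w → side-of (inside (τ ⟨$⟩ʳ B)) w (τ ⟨$⟩ʳ l)) (unmoved refl λ ()))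
          (comm (inside (τ ⟨$⟩ʳ B)) (inside (τ ⟨$⟩ʳ A)) (τ ⟨$⟩ʳ l))))

    belongs-split : ∀ (σ : State) {p} → σ ⟨$⟩ʳ A ≡ a → σ ⟨$⟩ʳ B ≡ b → σ ⟨$⟩ʳ l ≡ p →
      belongs σ ≡ inside p
    belongs-split σ refl refl refl rewrite inside-a | inside-b = refl

    place-split : ∀ {p} → a ≢ b → p ≢ a → p ≢ b →
      ∃[ σ ] (σ ⟨$⟩ʳ A ≡ a × σ ⟨$⟩ʳ B ≡ b × σ ⟨$⟩ʳ l ≡ p × Agree (allFin (4 + k)) id σ)
    place-split a≢b p≢a p≢b = place₃ id (λ ()) (≢-sym (token≢blank refl tl))
      (≢-sym (token≢blank refl tl)) a≢b (≢-sym p≢a) (≢-sym p≢b)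
      (∈-allFin _) (∈-allFin _) (∈-allFin _) (∈-allFin _) (∈-allFin _) (∈-allFin _)

    -- With the blanks at `a` and `b`, hence on different sides, a token belongs to the side where
    -- it stands. So the invariant compares the places `c` and `d` of one token.
    separates : ∀ {c d} → a ≢ b → c ≢ a → c ≢ b → d ≢ a → d ≢ b → Connected G → inside c ≡ inside d
    separates a≢b c≢a c≢b d≢a d≢b conn
      with σ , σA , σB , σl , _ ← place-split a≢b c≢a c≢b
      with τ , τA , τB , τl , _ ← place-split a≢b d≢a d≢b =
      trans (sym (belongs-split σ σA σB σl))
        (trans (constant belongs belongs-cong belongs-preserved conn σ τ)
          (belongs-split τ τA τB τl))

  cut-edge⇒disconnected : Connected Y → ∀ a b → NonTrivialCutEdge Y a b → ¬ Connected G
  cut-edge⇒disconnected connY a b ((ab , cut) , deg-a , deg-b) conn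
    with c , c≢b , ac ← second-neighbour Y deg-a ab
    with d , d≢a , bd ← second-neighbour Y deg-b (symm Y ab) =
    contradiction (trans (sym inside-c) (trans
      (separates sides token₀ refl a≢b (λ { refl → irrefl Y refl ac }) c≢b d≢a
        (λ { refl → irrefl Y refl bd }) conn) inside-d)) λ ()
    where
    sides = cut⇒bipartition Y connY cut
    open Bipartition sides

    a≢b : a ≢ b
    a≢b refl = irrefl Y refl ab

    inside-c : inside c ≡ true
    inside-c = trans (sym (kept ac λ
      { (inj₁ (_ , c≡b)) → c≢b c≡b ; (inj₂ (a≡b , _)) → a≢b a≡b })) inside-a

    inside-d : inside d ≡ false
    inside-d = trans (sym (kept bd λ
      { (inj₁ (b≡a , _)) → a≢b (sym b≡a) ; (inj₂ (_ , d≡a)) → d≢a d≡a })) inside-b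

-- Cyclic order of three tokens

orientation : ℕ → ℕ → ℕ → Bool
orientation i j m = (i <′ j) xor ((j <′ m) xor (m <′ i))

-- The parity of the ascents around a cyclic sequence: for distinct entries, `false` means two
-- ascents, the positive cyclic order, and `true` means one. A rotation permutes the three
-- comparisons.
orientation-rotate : ∀ i j m → orientation i j m ≡ orientation j m i
orientation-rotate i j m =
  trans (Bool.xor-comm (i <′ j) _) (Bool.xor-assoc (j <′ m) (m <′ i) (i <′ j))

-- All three comparisons are reversed, an odd number.
orientation-swap : ∀ {i j m} → i ≢ j → j ≢ m → i ≢ m → orientation j i m ≡ not (orientation i j m)
orientation-swap {i} {j} {m} i≢j j≢m i≢m
  rewrite <′-flip i≢j | <′-flip j≢m | <′-flip {m} {i} (≢-sym i≢m) = flips (i <′ j) (j <′ m) (m <′ i)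
  where
  flips : ∀ p q r → not p xor (not r xor not q) ≡ not (p xor (q xor r))
  flips false false false = refl
  flips false false true  = refl
  flips false true  false = refl
  flips false true  true  = refl
  flips true  false false = refl
  flips true  false true  = refl
  flips true  true  false = refl
  flips true  true  true  = refl

CyclicNext : ℕ → ℕ → ℕ → Set
CyclicNext n i j = suc i ≡ j ⊎ (suc i ≡ n × j ≡ 0)

-- No entry lies between `i` and its successor, so an ordinary step changes no comparison. The step
-- from the last position to 0 reverses both comparisons with the moving entry, and these changes
-- cancel.
orientation-step : ∀ {n i j r s} → CyclicNext n i j → r < n → s < n →
  r ≢ i → r ≢ j → s ≢ i → s ≢ j → orientation i r s ≡ orientation j r s
orientation-step {i = i} {r = r} {s} (inj₁ refl) _ _ r≢i r≢j s≢i s≢j =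
  cong₂ (λ p q → p xor ((r <′ s) xor q)) (above (i <? r)) (below (s <? i))
  where
  above : Dec (i < r) → i <′ r ≡ suc i <′ r
  above (yes i<r) = trans (dec-true (i <? r) i<r)
    (sym (dec-true (suc i <? r) (≤∧≢⇒< i<r (≢-sym r≢j))))
  above (no i≮r) = trans (dec-false (i <? r) i≮r) (sym (dec-false (suc i <? r) (i≮r ∘ <⇒≤)))

  below : Dec (s < i) → s <′ i ≡ s <′ suc i
  below (yes s<i) = trans (dec-true (s <? i) s<i) (sym (dec-true (s <? suc i) (ℕ.m<n⇒m<1+n s<i)))
  below (no s≮i) = trans (dec-false (s <? i) s≮i)
    (sym (dec-false (s <? suc i) λ { (s≤s s≤i) → s≮i (≤∧≢⇒< s≤i s≢i) }))
orientation-step {i = i} {r = r} {s} (inj₂ (refl , refl)) (s≤s r≤i) (s≤s s≤i) r≢i r≢j s≢i s≢j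
  rewrite dec-false (i <? r) (λ i<r → <⇒≱ i<r r≤i)
        | dec-true (0 <? r) (ℕ.n≢0⇒n>0 r≢j)
        | dec-true (s <? i) (≤∧≢⇒< s≤i s≢i)
        | dec-false (s <? 0) (λ ()) = wrap (r <′ s)
  where
  wrap : ∀ p → p xor true ≡ not (p xor false)
  wrap false = refl
  wrap true = refl

module CycleNecessity {k : ℕ} (Y : FinGraph (4 + k)) (3≤n : 3 ≤ 4 + k)
  (π : Permutation′ (4 + k))
  (edges : ∀ {u v} → Adj Y u v → Adj (cycle (4 + k) 3≤n) (π ⟨$⟩ʳ u) (π ⟨$⟩ʳ v)) where

  open Reach Y
  open Necessity Y

  spot : State → Label → ℕ
  spot σ l = toℕ (π ⟨$⟩ʳ (σ ⟨$⟩ʳ l))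

  spot-injective : ∀ (σ : State) {l l′} → l ≢ l′ → spot σ l ≢ spot σ l′
  spot-injective σ l≢l′ = distinct σ l≢l′ ∘ injective π ∘ toℕ-injective

  module _ {l₀ l₁ l₂ : Label}
    (t₀ : blank l₀ ≡ false) (t₁ : blank l₁ ≡ false) (t₂ : blank l₂ ≡ false)
    (l₀≢l₁ : l₀ ≢ l₁) (l₁≢l₂ : l₁ ≢ l₂) (l₀≢l₂ : l₀ ≢ l₂) where

    turn : State → Bool
    turn σ = orientation (spot σ l₀) (spot σ l₁) (spot σ l₂)

    turn-cong : ∀ {σ τ} → σ ≐ τ → turn σ ≡ turn τ
    turn-cong σ≐τ rewrite at σ≐τ l₀ | at σ≐τ l₁ | at σ≐τ l₂ = refl

    -- A move shifts at most one of the three tokens, and only to a neighbouring place on the cycle;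
    -- a rotation makes that token the first argument.
    turn-preserved : ∀ {σ τ x y} → IsMove σ τ x y → turn σ ≡ turn τ
    turn-preserved {σ} {τ} {x} {y} m = compare (l₀ ≟ y) (l₁ ≟ y) (l₂ ≟ y)
      where
      open IsMove m

      rest : ∀ {l} → blank l ≡ false → l ≢ y → spot σ l ≡ spot τ l
      rest tl l≢y = cong (toℕ ∘ (π ⟨$⟩ʳ_)) (sym (at-other (token≢blank blank-x tl) l≢y))

      jump : ∀ {r s} → blank r ≡ false → blank s ≡ false → r ≢ y → s ≢ y →
        orientation (spot σ y) (spot σ r) (spot σ s) ≡ orientation (spot τ y) (spot τ r) (spot τ s)
      jump {r} {s} tr ts r≢y s≢y
        rewrite sym (rest tr r≢y) | sym (rest ts s≢y) | at-y = either (edges adjacent)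
        where
        r≢x = spot-injective σ (token≢blank blank-x tr)
        s≢x = spot-injective σ (token≢blank blank-x ts)
        r≢y′ = spot-injective σ r≢y
        s≢y′ = spot-injective σ s≢y

        either :
          CyclicNext (4 + k) (spot σ x) (spot σ y) ⊎ CyclicNext (4 + k) (spot σ y) (spot σ x) →
          orientation (spot σ y) (spot σ r) (spot σ s)
            ≡ orientation (spot σ x) (spot σ r) (spot σ s)
        either (inj₁ next) = sym (orientation-step next (toℕ<n _) (toℕ<n _) r≢x r≢y′ s≢x s≢y′)
        either (inj₂ next) = orientation-step next (toℕ<n _) (toℕ<n _) r≢y′ r≢x s≢y′ s≢x

      rotate : ∀ (σ : State) a b c → orientation (spot σ a) (spot σ b) (spot σ c)
                                    ≡ orientation (spot σ b) (spot σ c) (spot σ a)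
      rotate σ a b c = orientation-rotate (spot σ a) (spot σ b) (spot σ c)

      compare : Dec (l₀ ≡ y) → Dec (l₁ ≡ y) → Dec (l₂ ≡ y) → turn σ ≡ turn τ
      compare (yes refl) _ _ = jump t₁ t₂ (≢-sym l₀≢l₁) (≢-sym l₀≢l₂)
      compare (no _) (yes refl) _ =
        trans (rotate σ l₀ l₁ l₂) (trans (jump t₂ t₀ (≢-sym l₁≢l₂) l₀≢l₁) (sym (rotate τ l₀ l₁ l₂)))
      compare (no _) (no _) (yes refl) =
        trans (sym (rotate σ l₂ l₀ l₁)) (trans (jump t₀ t₁ l₀≢l₂ l₁≢l₂) (rotate τ l₂ l₀ l₁))
      compare (no l₀≢y) (no l₁≢y) (no l₂≢y)
        rewrite rest t₀ l₀≢y | rest t₁ l₁≢y | rest t₂ l₂≢y = refl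

    three-tokens⇒disconnected : ¬ Connected G
    three-tokens⇒disconnected conn = Bool.not-¬ refl
      (trans (constant turn turn-cong turn-preserved conn id (id [ l₀ ⇄ l₁ ])) swapped)
      where
      spot-⇄ : ∀ {l l′} → id [ l₀ ⇄ l₁ ] ⟨$⟩ʳ l ≡ l′ → spot (id [ l₀ ⇄ l₁ ]) l ≡ spot id l′
      spot-⇄ eq = cong (toℕ ∘ (π ⟨$⟩ʳ_)) eq

      swapped : turn (id [ l₀ ⇄ l₁ ]) ≡ not (turn id)
      swapped
        rewrite spot-⇄ (⇄-first id l₀ l₁) | spot-⇄ (⇄-second id l₀ l₁)
              | spot-⇄ (⇄-other id (≢-sym l₀≢l₂) (≢-sym l₁≢l₂)) =
        orientation-swap (spot-injective id l₀≢l₁) (spot-injective id l₁≢l₂)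
          (spot-injective id l₀≢l₂)

odd : ℕ → Bool
odd zero = false
odd (suc i) = not (odd i)

four-cycle-bipartite : (Y : FinGraph 4) (3≤4 : 3 ≤ 4) → Y ≅ cycle 4 3≤4 → Bipartite Y
four-cycle-bipartite Y 3≤4 (π , iso) =
  (λ v → odd (toℕ (π ⟨$⟩ʳ v)))
  , λ u v uv → proper (toℕ (π ⟨$⟩ʳ u)) (toℕ (π ⟨$⟩ʳ v)) (Equivalence.to (iso u v) uv)
  where
  next : ∀ i j → CyclicNext 4 i j → odd j ≡ not (odd i)
  next i _ (inj₁ refl) = refl
  next _ _ (inj₂ (refl , refl)) = refl

  proper : ∀ i j → CyclicNext 4 i j ⊎ CyclicNext 4 j i → odd i ≢ odd j
  proper i j (inj₁ e) eq = Bool.not-¬ (sym eq) (next i j e)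
  proper i j (inj₂ e) eq = Bool.not-¬ eq (next j i e)

-- Three tokens require at least five vertices; with four, the parity invariant takes over.
cycle⇒disconnected : (Y : FinGraph (4 + k)) (3≤n : 3 ≤ 4 + k) →
  Y ≅ cycle (4 + k) 3≤n → ¬ Connected (FS (completeBipartite 2 (2 + k)) Y)
cycle⇒disconnected {zero} Y 3≤n iso
  with part , proper ← four-cycle-bipartite Y 3≤n iso =
  Necessity.bipartite⇒disconnected Y part proper
cycle⇒disconnected {suc k} Y 3≤n (π , iso) =
  CycleNecessity.three-tokens⇒disconnected Y 3≤n π (λ {u} {v} → Equivalence.to (iso u v))
    {suc (suc zero)} {suc (suc (suc zero))} {suc (suc (suc (suc zero)))} refl refl refl
    (λ ()) (λ ()) (λ ())

theorem1p4 : (n : ℕ) (4≤n : 4 ≤ n) (Y : FinGraph n) →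
    Connected (FS (completeBipartite 2 (n ∸ 2)) Y) ⇔
    (Connected Y
    × ¬ Bipartite Y
    × (∀ a b → ¬ NonTrivialCutEdge Y a b)
    × ¬ (Y ≅ cycle n (<⇒≤ 4≤n)))
theorem1p4 (suc (suc (suc (suc k)))) 4≤n@(s≤s (s≤s (s≤s (s≤s _)))) Y = mk⇔
  (λ conn →
    Necessity.connected Y conn
    , (λ (part , proper) → Necessity.bipartite⇒disconnected Y part proper conn)
    , (λ a b cut →
        CutEdgeNecessity.cut-edge⇒disconnected Y (Necessity.connected Y conn) a b cut conn)
    , λ iso → cycle⇒disconnected Y (<⇒≤ 4≤n) iso conn)
  (λ (conn , nonbipartite , cutless , noncycle) →
    sufficient conn nonbipartite cutless noncycle (fork? Y))
  where
  sufficient : Connected Y → ¬ Bipartite Y → (∀ a b → ¬ NonTrivialCutEdge Y a b) →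
    ¬ (Y ≅ cycle (4 + k) (<⇒≤ 4≤n)) → Dec (∃ (Fork Y)) →
    Connected (FS (completeBipartite 2 (2 + k)) Y)
  sufficient conn nonbipartite cutless noncycle
    (yes (_ , _ , _ , _ , ra , rb , rc , a≢b , a≢c , b≢c)) =
    Sufficiency.connected Y conn cutless nonbipartite ra rb rc a≢b a≢c b≢c
  sufficient conn nonbipartite cutless noncycle (no forkless) =
    contradiction (Forkless.forkless⇒cycle Y 4≤n conn cutless forkless (<⇒≤ 4≤n)) noncycle
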